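{- A matroid $\mathsf{M}$ of rank $k$ and size $n$ is elementary split if and only if after relaxing all the stressed subsets of $\mathsf{M}$ one obtains the uniform matroid $\mathsf{U}_{k,n}$.
   Context: $\mathsf{U}_{k,n}$ denotes the uniform matroid of rank $k$ on $n$ elements (up to isomorphism). Let $\mathsf{M}$ be a matroid on $E$ of rank $k$ with rank function $\operatorname{rk}$ and set of bases $\mathscr{B}$. Stressed subsets and relaxation: a subset $A\subseteq E$ is stressed if both $\mathsf{M}|_A$ and $\mathsf{M}/A$ are uniform matroids. The cover of $A$ is $\operatorname{cover}(A)=\{S\subseteq E: |S|=k,\ |S\cap A|\ge \operatorname{rk}(A)+1\}$. If $A$ is stressed, the relaxation $\operatorname{Rel}(\mathsf{M},A)$ is the matroid on $E$ with set of bases $\mathscr{B}\sqcup\operatorname{cover}(A)$. Relaxing a stressed subset with empty cover does not change the matroid. "Relaxing all the stressed subsets of $\mathsf{M}$" means: if $F_1,\dots,F_m$ are the stressed subsets of $\mathsf{M}$ with non-empty cover, one relaxes them one after another, $\mathsf{M}_0=\mathsf{M}$, $\mathsf{M}_i=\operatorname{Rel}(\mathsf{M}_{i-1},F_i)$, and considers the resulting matroid $\mathsf{M}_m$, whose set of bases is $\mathscr{B}\cup\bigcup_{i}\operatorname{cover}_{\mathsf{M}}(F_i)$. Elementary split matroids: a matroid is connected if it is not a direct sum of two matroids with non-empty ground sets. For a connected matroid $\mathsf{M}$ on $E$, a flacet is a flat $F$ such that $\mathsf{M}|_F$ and $\mathsf{M}/F$ are connected; a flacet $F$ is a split flacet if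 $0<\operatorname{rk}(F)<|F|$ and $E\smallsetminus F$ contains at least one element that is not a coloop of $\mathsf{M}$. A connected split matroid is a connected matroid all of whose split flacets are stressed. A matroid is elementary split if it is either a connected split matroid or a direct sum of two uniform matroids. -}

module Defs where

open import Data.Nat using (ℕ; _+_; _∸_; _≤_; _<_)
open import Data.Nat.Properties
  using (≤-trans; m≤m+n; m+n∸n≡m; m∸n+n≡m; ∸-monoˡ-≤;
         +-cancelʳ-≤; module ≤-Reasoning)
open import Data.Nat.Solver using (module +-*-Solver)
open import Data.Fin using (Fin)
open import Data.Fin.Subset
  using (Subset; _∈_; _∉_; _⊆_; _∪_; _∩_; _─_; ⁅_⁆; ∣_∣; Nonempty; Empty)
open import Data.Fin.Subset.Properties
  using (_∈?_; ∩-distribʳ-∪; ∪-distribʳ-∩; x∈p∩q⁺; x∈p∩q⁻; x∈p∪q⁺; x∈p∪q⁻; q⊆p∪q;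
         p─q⊆p; x∈p∧x∉q⇒x∈p─q; p⊆q⇒∣p∣≤∣q∣; ⊆-antisym)
open import Data.List using (List; []; _∷_)
import Data.List.Membership.Propositional as List
open import Data.List.Relation.Unary.Unique.Propositional using (Unique)
open import Data.Product using (∃; ∃-syntax; _×_; _,_; proj₁; proj₂)
open import Data.Sum using (_⊎_; inj₁; inj₂)
open import Function.Bundles using (_⇔_)
open import Relation.Binary.PropositionalEquality
  using (_≡_; refl; sym; trans; cong₂; subst₂)
open import Relation.Nullary using (¬_; yes; no)

-- A matroid whose ground set is a finite set E, presented by its rank function.
-- E is a subset of an ambient set Fin u, so that M|A and M/A (with ground sets
-- A and E ∖ A) are again matroids over the same u.  The rank function is
-- extended to all X ⊆ Fin u by rk X = rk (X ∩ E): this follows from the four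
-- axioms, since `rk-bounded` gives rk (X ∖ E) = 0, and on subsets of E they are
-- the usual rank axioms.
record Matroid (u : ℕ) : Set where
  field
    E             : Subset u
    rk            : Subset u → ℕ
    rk-bounded    : ∀ X → rk X ≤ ∣ X ∩ E ∣
    rk-monotone   : ∀ X Y → X ⊆ Y → rk X ≤ rk Y
    rk-submodular : ∀ X Y → rk (X ∪ Y) + rk (X ∩ Y) ≤ rk X + rk Y

  rank : ℕ
  rank = rk E

  size : ℕ
  size = ∣ E ∣

  IsBasis : Subset u → Set
  IsBasis B = B ⊆ E × rk B ≡ ∣ B ∣ × rk B ≡ rank

open Matroid

private
  variable
    u : ℕ

  ─∪ : (X A : Subset u) → X ∪ A ⊆ (X ─ A) ∪ A
  ─∪ X A {x} x∈X∪A with x ∈? A | x∈p∪q⁻ X A x∈X∪A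
  ... | yes x∈A | _        = x∈p∪q⁺ (inj₂ x∈A)
  ... | no  x∉A | inj₁ x∈X = x∈p∪q⁺ (inj₁ (x∈p∧x∉q⇒x∈p─q x∈X x∉A))
  ... | no  _   | inj₂ x∈A = x∈p∪q⁺ (inj₂ x∈A)

  ─⇒∉ : (X A : Subset u) {x : Fin u} → x ∈ X ─ A → x ∉ A
  ─⇒∉ X A x∈X─A x∈A = go X A x∈X─A x∈A
    where
    open import Data.Vec using (_∷_; here; there)
    open import Data.Bool using (true; false)
    go : ∀ {v} (X A : Subset v) {x : Fin v} → x ∈ X ─ A → ¬ (x ∈ A)
    go (_ ∷ _) (true ∷ _)  ()        here
    go (_ ∷ X) (_ ∷ A)     (there p) (there q) = go X A p q

  ∩-∩ : (X Y A : Subset u) → (X ∩ A) ∩ (Y ∩ A) ≡ (X ∩ Y) ∩ A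
  ∩-∩ X Y A = ⊆-antisym to from
    where
    to : (X ∩ A) ∩ (Y ∩ A) ⊆ (X ∩ Y) ∩ A
    to p with x∈p∩q⁻ (X ∩ A) (Y ∩ A) p
    ... | p₁ , p₂ =
      x∈p∩q⁺ (x∈p∩q⁺ (proj₁ (x∈p∩q⁻ X A p₁) , proj₁ (x∈p∩q⁻ Y A p₂)) , proj₂ (x∈p∩q⁻ X A p₁))
    from : (X ∩ Y) ∩ A ⊆ (X ∩ A) ∩ (Y ∩ A)
    from p with x∈p∩q⁻ (X ∩ Y) A p
    ... | p₁ , a with x∈p∩q⁻ X Y p₁
    ...   | x , y = x∈p∩q⁺ (x∈p∩q⁺ (x , a) , x∈p∩q⁺ (y , a))

  ∪-∪ : (X Y A : Subset u) → (X ∪ A) ∪ (Y ∪ A) ≡ (X ∪ Y) ∪ A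
  ∪-∪ X Y A = ⊆-antisym to from
    where
    to : (X ∪ A) ∪ (Y ∪ A) ⊆ (X ∪ Y) ∪ A
    to p with x∈p∪q⁻ (X ∪ A) (Y ∪ A) p
    to p | inj₁ q with x∈p∪q⁻ X A q
    ... | inj₁ x = x∈p∪q⁺ (inj₁ (x∈p∪q⁺ (inj₁ x)))
    ... | inj₂ a = x∈p∪q⁺ (inj₂ a)
    to p | inj₂ q with x∈p∪q⁻ Y A q
    ... | inj₁ y = x∈p∪q⁺ (inj₁ (x∈p∪q⁺ (inj₂ y)))
    ... | inj₂ a = x∈p∪q⁺ (inj₂ a)
    from : (X ∪ Y) ∪ A ⊆ (X ∪ A) ∪ (Y ∪ A)
    from p with x∈p∪q⁻ (X ∪ Y) A p
    from p | inj₂ a = x∈p∪q⁺ (inj₁ (x∈p∪q⁺ (inj₂ a)))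
    from p | inj₁ q with x∈p∪q⁻ X Y q
    ... | inj₁ x = x∈p∪q⁺ (inj₁ (x∈p∪q⁺ (inj₁ x)))
    ... | inj₂ y = x∈p∪q⁺ (inj₂ (x∈p∪q⁺ (inj₁ y)))

  ∸-submodular : ∀ {a b c d r} → r ≤ a → r ≤ b → r ≤ c → r ≤ d →
                 a + b ≤ c + d → (a ∸ r) + (b ∸ r) ≤ (c ∸ r) + (d ∸ r)
  ∸-submodular {a} {b} {c} {d} {r} r≤a r≤b r≤c r≤d a+b≤c+d =
    +-cancelʳ-≤ (r + r) _ _
      (subst₂ _≤_ (sym (shift r≤a r≤b)) (sym (shift r≤c r≤d)) a+b≤c+d)
    where
    shift : ∀ {x y} → r ≤ x → r ≤ y → (x ∸ r) + (y ∸ r) + (r + r) ≡ x + y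
    shift {x} {y} r≤x r≤y =
      trans (solve 3 (λ p q s → p :+ q :+ (s :+ s) := (p :+ s) :+ (q :+ s)) refl (x ∸ r) (y ∸ r) r)
            (cong₂ _+_ (m∸n+n≡m r≤x) (m∸n+n≡m r≤y))
      where open +-*-Solver

infixl 7 _∣ᴹ_ _/ᴹ_

_∣ᴹ_ : Matroid u → Subset u → Matroid u
M ∣ᴹ A = record
  { E             = E M ∩ A
  ; rk            = λ X → rk M (X ∩ A)
  ; rk-bounded    = λ X → ≤-trans (rk-bounded M (X ∩ A)) (p⊆q⇒∣p∣≤∣q∣ (bound X))
  ; rk-monotone   = λ X Y X⊆Y → rk-monotone M (X ∩ A) (Y ∩ A) (mono X Y X⊆Y)
  ; rk-submodular = λ X Y →
      subst₂ (λ P Q → rk M P + rk M Q ≤ rk M (X ∩ A) + rk M (Y ∩ A))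
        (sym (∩-distribʳ-∪ A X Y)) (∩-∩ X Y A)
        (rk-submodular M (X ∩ A) (Y ∩ A))
  }
  where
  bound : ∀ X → (X ∩ A) ∩ E M ⊆ X ∩ (E M ∩ A)
  bound X p with x∈p∩q⁻ (X ∩ A) (E M) p
  ... | q , e with x∈p∩q⁻ X A q
  ...   | x , a = x∈p∩q⁺ (x , x∈p∩q⁺ (e , a))
  mono : ∀ X Y → X ⊆ Y → X ∩ A ⊆ Y ∩ A
  mono X Y X⊆Y p with x∈p∩q⁻ X A p
  ... | x , a = x∈p∩q⁺ (X⊆Y x , a)

_/ᴹ_ : Matroid u → Subset u → Matroid u
M /ᴹ A = record
  { E             = E M ─ A
  ; rk            = λ X → rk M (X ∪ A) ∸ rk M A
  ; rk-bounded    = bounded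
  ; rk-monotone   = λ X Y X⊆Y →
      ∸-monoˡ-≤ (rk M A) (rk-monotone M (X ∪ A) (Y ∪ A) (mono X Y X⊆Y))
  ; rk-submodular = λ X Y →
      ∸-submodular (A≤ (X ∪ Y)) (A≤ (X ∩ Y)) (A≤ X) (A≤ Y)
        (subst₂ (λ P Q → rk M P + rk M Q ≤ rk M (X ∪ A) + rk M (Y ∪ A))
          (∪-∪ X Y A) (sym (∪-distribʳ-∩ A X Y))
          (rk-submodular M (X ∪ A) (Y ∪ A)))
  }
  where
  A≤ : ∀ X → rk M A ≤ rk M (X ∪ A)
  A≤ X = rk-monotone M A (X ∪ A) (q⊆p∪q X A)
  mono : ∀ X Y → X ⊆ Y → X ∪ A ⊆ Y ∪ A
  mono X Y X⊆Y p with x∈p∪q⁻ X A p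
  ... | inj₁ x = x∈p∪q⁺ (inj₁ (X⊆Y x))
  ... | inj₂ a = x∈p∪q⁺ (inj₂ a)
  bound : ∀ X → (X ─ A) ∩ E M ⊆ X ∩ (E M ─ A)
  bound X p with x∈p∩q⁻ (X ─ A) (E M) p
  ... | q , e = x∈p∩q⁺ (p─q⊆p X A q , x∈p∧x∉q⇒x∈p─q e (─⇒∉ X A q))
  bounded : ∀ X → rk M (X ∪ A) ∸ rk M A ≤ ∣ X ∩ (E M ─ A) ∣
  bounded X = begin
    rk M (X ∪ A) ∸ rk M A
      ≤⟨ ∸-monoˡ-≤ (rk M A) (rk-monotone M (X ∪ A) ((X ─ A) ∪ A) (─∪ X A)) ⟩
    rk M ((X ─ A) ∪ A) ∸ rk M A
      ≤⟨ ∸-monoˡ-≤ (rk M A) (≤-trans (m≤m+n _ _) (rk-submodular M (X ─ A) A)) ⟩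
    rk M (X ─ A) + rk M A ∸ rk M A
      ≡⟨ m+n∸n≡m (rk M (X ─ A)) (rk M A) ⟩
    rk M (X ─ A)
      ≤⟨ rk-bounded M (X ─ A) ⟩
    ∣ (X ─ A) ∩ E M ∣
      ≤⟨ p⊆q⇒∣p∣≤∣q∣ (bound X) ⟩
    ∣ X ∩ (E M ─ A) ∣ ∎
    where open ≤-Reasoning

-- M is the uniform matroid of rank k on n elements, up to isomorphism.
-- No bijection appears: the family of all k-subsets is invariant under every
-- bijection of ground sets.
IsU : ℕ → ℕ → Matroid u → Set
IsU k n M = size M ≡ n × (∀ S → IsBasis M S ⇔ (S ⊆ E M × ∣ S ∣ ≡ k))

Uniform : Matroid u → Set
Uniform M = ∃[ k ] ∃[ n ] IsU k n M

record IsDirectSum (M M₁ M₂ : Matroid u) : Set where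
  field
    disjoint : Empty (E M₁ ∩ E M₂)
    ground   : E M ≡ E M₁ ∪ E M₂
    rk-sum   : ∀ X → rk M X ≡ rk M₁ (X ∩ E M₁) + rk M₂ (X ∩ E M₂)

Connected : Matroid u → Set
Connected M =
  ¬ (∃[ M₁ ] ∃[ M₂ ] Nonempty (E M₁) × Nonempty (E M₂) × IsDirectSum M M₁ M₂)

Stressed : Matroid u → Subset u → Set
Stressed M A = A ⊆ E M × Uniform (M ∣ᴹ A) × Uniform (M /ᴹ A)

Cover : Matroid u → Subset u → Subset u → Set
Cover M A S = S ⊆ E M × ∣ S ∣ ≡ rank M × rk M A + 1 ≤ ∣ S ∩ A ∣

-- N = Rel(M, A).  This determines N, since a rank function is determined by the
-- ground set and the bases; the union is automatically disjoint, since a member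
-- of Cover M A meets A in more than rk A elements.
record IsRel (M : Matroid u) (A : Subset u) (N : Matroid u) : Set where
  field
    stressed : Stressed M A
    ground   : E N ≡ E M
    bases    : ∀ S → IsBasis N S ⇔ (IsBasis M S ⊎ Cover M A S)

-- Relaxes M (F₁ ∷ … ∷ Fₘ ∷ []) N: there are matroids M = M₀, …, Mₘ = N with
-- Mᵢ = Rel(Mᵢ₋₁, Fᵢ); each Fᵢ has to be stressed in Mᵢ₋₁.
data Relaxes {u : ℕ} : Matroid u → List (Subset u) → Matroid u → Set where
  []  : ∀ {M} → Relaxes M [] M
  _∷_ : ∀ {M M′ N F Fs} → IsRel M F M′ → Relaxes M′ Fs N → Relaxes M (F ∷ Fs) N

-- Fs lists, without repetition and in some order, the stressed subsets of M with
-- non-empty cover.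
record ListsStressed (M : Matroid u) (Fs : List (Subset u)) : Set where
  field
    unique   : Unique Fs
    complete : ∀ F → F List.∈ Fs ⇔ (Stressed M F × ∃ (Cover M F))

Flat : Matroid u → Subset u → Set
Flat M F = F ⊆ E M × (∀ x → x ∈ E M → x ∉ F → rk M F < rk M (F ∪ ⁅ x ⁆))

Coloop : Matroid u → Fin u → Set
Coloop M x = x ∈ E M × (∀ B → IsBasis M B → x ∈ B)

-- Only used for connected M.
Flacet : Matroid u → Subset u → Set
Flacet M F = Flat M F × Connected (M ∣ᴹ F) × Connected (M /ᴹ F)

SplitFlacet : Matroid u → Subset u → Set
SplitFlacet M F =
  Flacet M F × 0 < rk M F × rk M F < ∣ F ∣ × (∃[ x ] x ∈ E M ─ F × ¬ Coloop M x)

ConnectedSplit : Matroid u → Set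
ConnectedSplit M = Connected M × (∀ F → SplitFlacet M F → Stressed M F)

ElementarySplit : Matroid u → Set
ElementarySplit M =
  ConnectedSplit M ⊎ (∃[ M₁ ] ∃[ M₂ ] IsDirectSum M M₁ M₂ × Uniform M₁ × Uniform M₂)

{-# OPTIONS --safe #-}

-- Relaxing all stressed subsets yields U_{k,n} iff every k-set S that is not a
-- basis lies in the cover of some stressed A, that is, |S ∩ A| > rk A.
-- Relaxations can be chained because two distinct stressed subsets with nonempty
-- cover meet in an independent set, so that relaxing one leaves the other alone.
--
-- Let M be connected and S a k-set that is not a basis.  A minimal F with
-- |S ∩ F| > rk F has M|F connected.  If D separates M/F, then M|(F ∪ D) and
-- M|(E ∖ D) are connected as well, and since F ↦ |S ∩ F| - rk F is supermodular
-- and vanishes on E, it is positive on one of the two sets; hence a maximal such F is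
-- a flacet, and in fact a split flacet.
--
-- Conversely, suppose that the covers of the stressed subsets contain all
-- k-sets other than the bases.  For a split flacet F, choose a k-set S exceeding
-- the rank by 1 on F and by at most 1 everywhere; a stressed A whose cover contains
-- S must be F.  If M is not connected and A is stressed with nonempty cover, then A
-- separates M, and M = M|A ⊕ M|(E ∖ A) with both summands uniform.

module Submission where

open import Defs
open import Data.Bool using (Bool; true; false; T; not; _∧_; _∨_)
open import Data.Bool.Properties using (T-∧)
open import Data.Fin using (Fin; zero; suc)
open import Data.Fin.Subset
open import Data.Fin.Subset.Properties
open import Data.List using (List; []; _∷_)
import Data.List.Membership.Propositional as List
open import Data.List.Relation.Unary.All as All using (All; []; _∷_)
open import Data.List.Relation.Unary.AllPairs using ([]; _∷_)
open import Data.List.Relation.Unary.Any using (here; there)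
open import Data.List.Relation.Unary.Unique.Propositional using (Unique)
open import Data.Nat using (ℕ; zero; suc; _+_; _*_; _∸_; _⊓_; _≤_; _<_; _≤ᵇ_; _≤?_; _<?_; z≤n; s≤s)
open import Data.Nat.Properties
open import Data.Nat.Solver using (module +-*-Solver)
open import Data.Product using (∃; ∃-syntax; _×_; _,_; proj₁; proj₂)
open import Data.Sum using (_⊎_; inj₁; inj₂; [_,_]′)
open import Data.Unit using (tt)
open import Data.Vec as Vec using (Vec; []; _∷_; lookup; here; there)
open import Data.Vec.N-ary using (N-ary; _$ⁿ_)
open import Data.Vec.Properties using (lookup-map)
open import Function.Base using (_∘_; id)
open import Function.Bundles using (Equivalence; _⇔_; mk⇔)
open import Relation.Binary.PropositionalEquality
open import Relation.Nullary using (Dec; yes; no; ¬_; contradiction; _×-dec_)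
open import Relation.Nullary.Decidable using (map′)

open Matroid

private
  variable
    m u : ℕ

-- Decision by reflection

infix 3 _⊢_

record Sequent (H G : Set) : Set where
  constructor _⊢_
  field
    hypotheses : List H
    goal       : G

every : ∀ m → (Vec Bool m → Bool) → Bool
every zero    f = f []
every (suc m) f = every m (λ b → f (true ∷ b)) ∧ every m (λ b → f (false ∷ b))

every-sound : ∀ m f → T (every m f) → ∀ b → T (f b)
every-sound zero    f t []          = t
every-sound (suc m) f t (true  ∷ b) = every-sound m _ (proj₁ (Equivalence.to T-∧ t)) b
every-sound (suc m) f t (false ∷ b) = every-sound m _ (proj₂ (Equivalence.to (T-∧ {every m _}) t)) b

-- Boolean reflection: an inclusion between Boolean expressions in subsets, or an
-- inequality between sums of their cardinalities, holds as soon as it holds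
-- pointwise, that is, for all truth values of the variables.
module SetSolver where

  infixr 7 _∩′_
  infixr 6 _∪′_
  infixl 5 _─′_
  infixl 5 _+′_
  infix  4 _⊆′_ _≤′_

  data SetExpr (m : ℕ) : Set where
    var            : Fin m → SetExpr m
    ⊥′             : SetExpr m
    _∩′_ _∪′_ _─′_ : (e f : SetExpr m) → SetExpr m

  data CardExpr (m : ℕ) : Set where
    ∣_∣′ : SetExpr m → CardExpr m
    _+′_ : (c d : CardExpr m) → CardExpr m

  data Formula (m : ℕ) : Set where
    _⊆′_ : (e f : SetExpr m) → Formula m
    _≤′_ : (c d : CardExpr m) → Formula m

  member : SetExpr m → Vec Bool m → Bool
  member (var i)  b = lookup b i
  member ⊥′       b = false
  member (e ∩′ f) b = member e b ∧ member f b
  member (e ∪′ f) b = member e b ∨ member f b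
  member (e ─′ f) b = member e b ∧ not (member f b)

  weight : CardExpr m → Vec Bool m → ℕ
  weight ∣ e ∣′   b with member e b
  ... | true  = 1
  ... | false = 0
  weight (c +′ d) b = weight c b + weight d b

  pointwise : Formula m → Vec Bool m → Bool
  pointwise (e ⊆′ f) b = not (member e b) ∨ member f b
  pointwise (c ≤′ d) b = weight c b ≤ᵇ weight d b

  entails : List (SetExpr m × SetExpr m) → Formula m → Vec Bool m → Bool
  entails []             g b = pointwise g b
  entails ((e , f) ∷ hs) g b = not (not (member e b) ∨ member f b) ∨ entails hs g b

  ⟦_⟧ˢ : SetExpr m → Vec (Subset u) m → Subset u
  ⟦ var i  ⟧ˢ ρ = lookup ρ i
  ⟦ ⊥′     ⟧ˢ ρ = ⊥
  ⟦ e ∩′ f ⟧ˢ ρ = ⟦ e ⟧ˢ ρ ∩ ⟦ f ⟧ˢ ρ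
  ⟦ e ∪′ f ⟧ˢ ρ = ⟦ e ⟧ˢ ρ ∪ ⟦ f ⟧ˢ ρ
  ⟦ e ─′ f ⟧ˢ ρ = ⟦ e ⟧ˢ ρ ─ ⟦ f ⟧ˢ ρ

  ⟦_⟧ᶜ : CardExpr m → Vec (Subset u) m → ℕ
  ⟦ ∣ e ∣′ ⟧ᶜ ρ = ∣ ⟦ e ⟧ˢ ρ ∣
  ⟦ c +′ d ⟧ᶜ ρ = ⟦ c ⟧ᶜ ρ + ⟦ d ⟧ᶜ ρ

  ⟦_⟧ᶠ : Formula m → Vec (Subset u) m → Set
  ⟦ e ⊆′ f ⟧ᶠ ρ = ⟦ e ⟧ˢ ρ ⊆ ⟦ f ⟧ˢ ρ
  ⟦ c ≤′ d ⟧ᶠ ρ = ⟦ c ⟧ᶜ ρ ≤ ⟦ d ⟧ᶜ ρ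

  private
    heads : Vec (Subset (suc u)) m → Vec Bool m
    heads = Vec.map Vec.head

    tails : Vec (Subset (suc u)) m → Vec (Subset u) m
    tails = Vec.map Vec.tail

    head∷tail : (p : Subset (suc u)) → p ≡ Vec.head p ∷ Vec.tail p
    head∷tail (_ ∷ _) = refl

    ─-∷ : ∀ a b (p q : Subset u) → (a ∷ p) ─ (b ∷ q) ≡ (a ∧ not b) ∷ (p ─ q)
    ─-∷ true  true  p q = refl
    ─-∷ true  false p q = refl
    ─-∷ false true  p q = refl
    ─-∷ false false p q = refl

    ⟦⟧ˢ-split : ∀ e (ρ : Vec (Subset (suc u)) m) →
                ⟦ e ⟧ˢ ρ ≡ member e (heads ρ) ∷ ⟦ e ⟧ˢ (tails ρ)
    ⟦⟧ˢ-split (var i)  ρ rewrite lookup-map i Vec.head ρ | lookup-map i Vec.tail ρ =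
      head∷tail (lookup ρ i)
    ⟦⟧ˢ-split ⊥′       ρ = refl
    ⟦⟧ˢ-split (e ∩′ f) ρ = cong₂ _∩_ (⟦⟧ˢ-split e ρ) (⟦⟧ˢ-split f ρ)
    ⟦⟧ˢ-split (e ∪′ f) ρ = cong₂ _∪_ (⟦⟧ˢ-split e ρ) (⟦⟧ˢ-split f ρ)
    ⟦⟧ˢ-split (e ─′ f) ρ =
      trans (cong₂ _─_ (⟦⟧ˢ-split e ρ) (⟦⟧ˢ-split f ρ)) (─-∷ (member e _) (member f _) _ _)

    ⟦⟧ᶜ-split : ∀ c (ρ : Vec (Subset (suc u)) m) →
                ⟦ c ⟧ᶜ ρ ≡ weight c (heads ρ) + ⟦ c ⟧ᶜ (tails ρ)
    ⟦⟧ᶜ-split ∣ e ∣′ ρ rewrite ⟦⟧ˢ-split e ρ with member e (heads ρ)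
    ... | true  = refl
    ... | false = refl
    ⟦⟧ᶜ-split (c +′ d) ρ rewrite ⟦⟧ᶜ-split c ρ | ⟦⟧ᶜ-split d ρ =
      solve 4 (λ a b x y → (a :+ x) :+ (b :+ y) := (a :+ b) :+ (x :+ y)) refl
        (weight c (heads ρ)) (weight d (heads ρ)) (⟦ c ⟧ᶜ (tails ρ)) (⟦ d ⟧ᶜ (tails ρ))
      where open +-*-Solver

    ⟦⟧ᶜ-[] : ∀ (c : CardExpr m) (ρ : Vec (Subset 0) m) → ⟦ c ⟧ᶜ ρ ≡ 0
    ⟦⟧ᶜ-[] ∣ e ∣′ ρ with ⟦ e ⟧ˢ ρ
    ... | [] = refl
    ⟦⟧ᶜ-[] (c +′ d) ρ rewrite ⟦⟧ᶜ-[] c ρ | ⟦⟧ᶜ-[] d ρ = refl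

    Holds : List (SetExpr m × SetExpr m) → Vec (Subset u) m → Set
    Holds hs ρ = All (λ { (e , f) → ⟦ e ⟧ˢ ρ ⊆ ⟦ f ⟧ˢ ρ }) hs

    ∷⊆∷⇒T : ∀ a b {p q : Subset u} → a ∷ p ⊆ b ∷ q → T (not a ∨ b)
    ∷⊆∷⇒T false b     _  = tt
    ∷⊆∷⇒T true  true  _  = tt
    ∷⊆∷⇒T true  false ⊆q with ⊆q here
    ... | ()

    T⇒∷⊆∷ : ∀ a b {p q : Subset u} → T (not a ∨ b) → p ⊆ q → a ∷ p ⊆ b ∷ q
    T⇒∷⊆∷ false b    _ p⊆q (there x∈p) = there (p⊆q x∈p)
    T⇒∷⊆∷ true  true _ p⊆q here        = here
    T⇒∷⊆∷ true  true _ p⊆q (there x∈p) = there (p⊆q x∈p)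

    Holds-tails : ∀ hs {ρ : Vec (Subset (suc u)) m} → Holds hs ρ → Holds hs (tails ρ)
    Holds-tails []             []           = []
    Holds-tails ((e , f) ∷ hs) {ρ} (p ∷ ps) =
      drop-∷-⊆ (subst₂ _⊆_ (⟦⟧ˢ-split e ρ) (⟦⟧ˢ-split f ρ) p) ∷ Holds-tails hs ps

    entails-heads : ∀ hs g {ρ : Vec (Subset (suc u)) m} → Holds hs ρ →
                    T (entails hs g (heads ρ)) → T (pointwise g (heads ρ))
    entails-heads []             g     []       t = t
    entails-heads ((e , f) ∷ hs) g {ρ} (p ∷ ps) t
      with not (member e (heads ρ)) ∨ member f (heads ρ)
         | ∷⊆∷⇒T _ (member f (heads ρ)) (subst₂ _⊆_ (⟦⟧ˢ-split e ρ) (⟦⟧ˢ-split f ρ) p)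
    ... | true | _ = entails-heads hs g ps t

    -- Induction on `u`. The first positions of all sets form one truth assignment, which the check
    -- on `b` settles; the remaining positions satisfy the same hypotheses.
    sound : ∀ hs g → (∀ b → T (entails hs g b)) → (ρ : Vec (Subset u) m) → Holds hs ρ → ⟦ g ⟧ᶠ ρ
    sound {zero}  hs (e ⊆′ f) t ρ ps {()}
    sound {zero}  hs (c ≤′ d) t ρ ps rewrite ⟦⟧ᶜ-[] c ρ = z≤n
    sound {suc u} hs (e ⊆′ f) t ρ ps =
      subst₂ _⊆_ (sym (⟦⟧ˢ-split e ρ)) (sym (⟦⟧ˢ-split f ρ))
        (T⇒∷⊆∷ _ _ (entails-heads hs (e ⊆′ f) ps (t (heads ρ)))
          (sound hs (e ⊆′ f) t (tails ρ) (Holds-tails hs ps)))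
    sound {suc u} hs (c ≤′ d) t ρ ps =
      subst₂ _≤_ (sym (⟦⟧ᶜ-split c ρ)) (sym (⟦⟧ᶜ-split d ρ))
        (+-mono-≤ (≤ᵇ⇒≤ _ _ (entails-heads hs (c ≤′ d) ps (t (heads ρ))))
          (sound hs (c ≤′ d) t (tails ρ) (Holds-tails hs ps)))

  SetSequent : ℕ → Set
  SetSequent m = Sequent (SetExpr m × SetExpr m) (Formula m)

  valid : SetSequent m → Bool
  valid (hs ⊢ g) = every _ (entails hs g)

  Proves : SetSequent m → Vec (Subset u) m → Set
  Proves (hs ⊢ g) ρ = Holds hs ρ → ⟦ g ⟧ᶠ ρ

  variables : Vec (SetExpr m) m
  variables = Vec.map var (Vec.allFin _)

  -- Abstract, because with-abstractions would otherwise normalise these proofs.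
  abstract
    sets : (ρ : Vec (Subset u) m) (s : N-ary m (SetExpr m) (SetSequent m)) →
           {T (valid (s $ⁿ variables))} → Proves (s $ⁿ variables) ρ
    sets ρ s {t} = prove (s $ⁿ variables) t
      where
      prove : ∀ p → T (valid p) → Proves p ρ
      prove (hs ⊢ g) t = sound hs g (every-sound _ _ t) ρ

-- A certificate checker for linear arithmetic over ℕ: the goal l ≤ r follows from
-- the hypotheses lᵢ ≤ rᵢ if l + Σ rᵢ ≤ r + Σ lᵢ holds coefficientwise.
module LinearSolver where

  infixl 6 _:+_
  infix  4 _:≤_

  data Expr (m : ℕ) : Set where
    var  : Fin m → Expr m
    con  : ℕ → Expr m
    _:+_ : (e f : Expr m) → Expr m

  record Inequality (m : ℕ) : Set where
    constructor _:≤_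
    field
      lhs rhs : Expr m

  unit : Fin m → Vec ℕ m
  unit zero    = 1 ∷ Vec.replicate _ 0
  unit (suc i) = 0 ∷ unit i

  -- The first entry is the constant term.
  coefficients : Expr m → Vec ℕ (suc m)
  coefficients (var i)  = 0 ∷ unit i
  coefficients (con n)  = n ∷ Vec.replicate _ 0
  coefficients (e :+ f) = Vec.zipWith _+_ (coefficients e) (coefficients f)

  dot : Vec ℕ m → Vec ℕ m → ℕ
  dot []       []       = 0
  dot (a ∷ as) (x ∷ xs) = a * x + dot as xs

  dominated : Vec ℕ m → Vec ℕ m → Bool
  dominated []       []       = true
  dominated (a ∷ as) (b ∷ bs) = (a ≤ᵇ b) ∧ dominated as bs

  ⟦_⟧ : Expr m → Vec ℕ m → ℕ
  ⟦ var i  ⟧ ρ = lookup ρ i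
  ⟦ con n  ⟧ ρ = n
  ⟦ e :+ f ⟧ ρ = ⟦ e ⟧ ρ + ⟦ f ⟧ ρ

  Holds : Vec ℕ m → Inequality m → Set
  Holds ρ (e :≤ f) = ⟦ e ⟧ ρ ≤ ⟦ f ⟧ ρ

  total : List (Inequality m) → Inequality m
  total []              = con 0 :≤ con 0
  total ((e :≤ f) ∷ hs) = let e′ :≤ f′ = total hs in e :+ e′ :≤ f :+ f′

  certifies : List (Inequality m) → Inequality m → Bool
  certifies hs (e :≤ f) =
    let l :≤ r = total hs in dominated (coefficients (e :+ r)) (coefficients (f :+ l))

  private
    dot-0 : (xs : Vec ℕ m) → dot (Vec.replicate m 0) xs ≡ 0
    dot-0 []       = refl
    dot-0 (x ∷ xs) = dot-0 xs

    dot-unit : ∀ i (xs : Vec ℕ m) → dot (unit i) xs ≡ lookup xs i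
    dot-unit zero    (x ∷ xs) rewrite dot-0 xs = trans (+-identityʳ _) (*-identityˡ x)
    dot-unit (suc i) (x ∷ xs) = dot-unit i xs

    dot-+ : (as bs xs : Vec ℕ m) → dot (Vec.zipWith _+_ as bs) xs ≡ dot as xs + dot bs xs
    dot-+ []       []       []       = refl
    dot-+ (a ∷ as) (b ∷ bs) (x ∷ xs) rewrite dot-+ as bs xs =
      solve 5 (λ a b x p q → (a :+ₛ b) :* x :+ₛ (p :+ₛ q) := (a :* x :+ₛ p) :+ₛ (b :* x :+ₛ q))
        refl a b x (dot as xs) (dot bs xs)
      where open +-*-Solver renaming (_:+_ to _:+ₛ_)

    dot-mono : (as bs xs : Vec ℕ m) → T (dominated as bs) → dot as xs ≤ dot bs xs
    dot-mono []       []       []       _ = z≤n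
    dot-mono (a ∷ as) (b ∷ bs) (x ∷ xs) t =
      let a≤b , as≤bs = Equivalence.to T-∧ t
      in +-mono-≤ (*-monoˡ-≤ x (≤ᵇ⇒≤ a b a≤b)) (dot-mono as bs xs as≤bs)

    ⟦⟧-dot : ∀ e (ρ : Vec ℕ m) → ⟦ e ⟧ ρ ≡ dot (coefficients e) (1 ∷ ρ)
    ⟦⟧-dot (var i)  ρ = sym (dot-unit i ρ)
    ⟦⟧-dot (con n)  ρ rewrite dot-0 ρ = sym (trans (+-identityʳ _) (*-identityʳ n))
    ⟦⟧-dot (e :+ f) ρ =
      trans (cong₂ _+_ (⟦⟧-dot e ρ) (⟦⟧-dot f ρ))
        (sym (dot-+ (coefficients e) (coefficients f) (1 ∷ ρ)))

    total-holds : ∀ hs {ρ : Vec ℕ m} → All (Holds ρ) hs → Holds ρ (total hs)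
    total-holds []              []       = z≤n
    total-holds ((_ :≤ _) ∷ hs) (p ∷ ps) = +-mono-≤ p (total-holds hs ps)

    sound : ∀ hs g → T (certifies hs g) → (ρ : Vec ℕ m) → All (Holds ρ) hs → Holds ρ g
    -- The hypotheses are moved across without subtraction: the sum `r` of their right-hand sides is
    -- added to both sides and cancelled at the end.
    sound hs (e :≤ f) t ρ ps = +-cancelʳ-≤ (⟦ r ⟧ ρ) (⟦ e ⟧ ρ) (⟦ f ⟧ ρ) (begin
      ⟦ e ⟧ ρ + ⟦ r ⟧ ρ                     ≡⟨ ⟦⟧-dot (e :+ r) ρ ⟩
      dot (coefficients (e :+ r)) (1 ∷ ρ)   ≤⟨ dot-mono (coefficients (e :+ r)) _ (1 ∷ ρ) t ⟩
      dot (coefficients (f :+ l)) (1 ∷ ρ)   ≡⟨ ⟦⟧-dot (f :+ l) ρ ⟨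
      ⟦ f ⟧ ρ + ⟦ l ⟧ ρ                     ≤⟨ +-monoʳ-≤ (⟦ f ⟧ ρ) (total-holds hs ps) ⟩
      ⟦ f ⟧ ρ + ⟦ r ⟧ ρ                     ∎)
      where
      open ≤-Reasoning
      open Inequality (total hs) renaming (lhs to l; rhs to r)

  LinearSequent : ℕ → Set
  LinearSequent m = Sequent (Inequality m) (Inequality m)

  valid : LinearSequent m → Bool
  valid (hs ⊢ g) = certifies hs g

  Proves : LinearSequent m → Vec ℕ m → Set
  Proves (hs ⊢ g) ρ = All (Holds ρ) hs → Holds ρ g

  variables : Vec (Expr m) m
  variables = Vec.map var (Vec.allFin _)

  abstract
    -- The sequent is a function of its variables, so that they can be named at each use; the
    -- implicit validity argument is found by evaluation.
    linear : (ρ : Vec ℕ m) (s : N-ary m (Expr m) (LinearSequent m)) →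
             {T (valid (s $ⁿ variables))} → Proves (s $ⁿ variables) ρ
    linear ρ s {t} = prove (s $ⁿ variables) t
      where
      prove : ∀ p → T (valid p) → Proves p ρ
      prove (hs ⊢ g) t = sound hs g t ρ

open SetSolver using (_⊆′_; _≤′_; _∩′_; _∪′_; _─′_; ⊥′; ∣_∣′; _+′_; sets)
open LinearSolver using (linear; _:+_; _:≤_; con)

-- Rank inequalities and extension of independent sets

⁅x⁆⊆ : {x : Fin u} {X : Subset u} → x ∈ X → ⁅ x ⁆ ⊆ X
⁅x⁆⊆ {x = x} x∈X y∈ with refl ← x∈⁅y⁆⇒x≡y x y∈ = x∈X

x∈p─q⇒x∉q : (p q : Subset u) {x : Fin u} → x ∈ p ─ q → x ∉ q
x∈p─q⇒x∉q p q x∈p─q x∈q =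
  ∉⊥ (sets (p ∷ q ∷ []) (λ p q → [] ⊢ (p ─′ q) ∩′ q ⊆′ ⊥′) [] (x∈p∩q⁺ (x∈p─q , x∈q)))

module _ (M : Matroid u) where

  Independent : Subset u → Set
  Independent X = ∣ X ∣ ≤ rk M X

  rk≤∣∣ : ∀ X → rk M X ≤ ∣ X ∣
  rk≤∣∣ X = ≤-trans (rk-bounded M X) (∣p∩q∣≤∣p∣ X (E M))

  rk-submodular-⊆ : ∀ {X Y Z W} → Z ⊆ X ∪ Y → W ⊆ X ∩ Y → rk M Z + rk M W ≤ rk M X + rk M Y
  rk-submodular-⊆ {X} {Y} Z⊆ W⊆ =
    ≤-trans (+-mono-≤ (rk-monotone M _ _ Z⊆) (rk-monotone M _ _ W⊆)) (rk-submodular M X Y)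

  rk-subadditive : ∀ {X Y Z} → Z ⊆ X ∪ Y → rk M Z ≤ rk M X + rk M Y
  rk-subadditive Z⊆ = ≤-trans (m≤m+n _ _) (rk-submodular-⊆ Z⊆ ⊥⊆)

  rk≤rk+∣─∣ : ∀ X Y → rk M Y ≤ rk M X + ∣ Y ─ X ∣
  rk≤rk+∣─∣ X Y = ≤-trans
    (rk-subadditive (sets (X ∷ Y ∷ []) (λ X Y → [] ⊢ Y ⊆′ X ∪′ (Y ─′ X)) []))
    (+-monoʳ-≤ _ (rk≤∣∣ (Y ─ X)))

  rk-∩E : ∀ X → rk M X ≤ rk M (X ∩ E M)
  rk-∩E X = linear (rk M X ∷ rk M (X ∩ E M) ∷ rk M (X ─ E M) ∷ ∣ (X ─ E M) ∩ E M ∣ ∷ [])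
    (λ x y z e → (x :≤ y :+ z) ∷ (z :≤ e) ∷ (e :≤ con 0) ∷ [] ⊢ x :≤ y)
    ( rk-subadditive (sets (X ∷ E M ∷ []) (λ X E → [] ⊢ X ⊆′ X ∩′ E ∪′ (X ─′ E)) [])
    ∷ rk-bounded M (X ─ E M)
    ∷ ≤-trans (sets (X ∷ E M ∷ []) (λ X E → [] ⊢ ∣ (X ─′ E) ∩′ E ∣′ ≤′ ∣ ⊥′ ∣′) []) (≤-reflexive (∣⊥∣≡0 u))
    ∷ [])

  rk≤rank : ∀ X → rk M X ≤ rank M
  rk≤rank X = ≤-trans (rk-∩E X) (rk-monotone M _ _ (p∩q⊆q X (E M)))

  independent-⊆ : ∀ {X Y} → X ⊆ Y → Independent Y → Independent X
  independent-⊆ {X} {Y} X⊆Y ∣Y∣≤ =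
    linear (∣ X ∣ ∷ ∣ Y ∣ ∷ ∣ Y ─ X ∣ ∷ rk M X ∷ rk M Y ∷ [])
      (λ x y d rX rY → (y :≤ rY) ∷ (rY :≤ rX :+ d) ∷ (x :+ d :≤ y) ∷ [] ⊢ x :≤ rX)
      ( ∣Y∣≤ ∷ rk≤rk+∣─∣ X Y
      ∷ sets (X ∷ Y ∷ []) (λ X Y → (X , Y) ∷ [] ⊢ ∣ X ∣′ +′ ∣ Y ─′ X ∣′ ≤′ ∣ Y ∣′) (X⊆Y ∷ []) ∷ [])

  independent⊆E : ∀ {X} → Independent X → X ⊆ E M
  independent⊆E {X} ∣X∣≤ {x} x∈X with x ∈? E M
  ... | yes x∈E = x∈E
  ... | no  x∉E = contradiction (≤-trans ∣X∣≤ (rk-bounded M X))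
    (<⇒≱ (p⊂q⇒∣p∣<∣q∣ (p∩q⊆p X (E M) , x , x∈X , x∉E ∘ proj₂ ∘ x∈p∩q⁻ X (E M))))

  private
    -- Recursion on a bound for `∣ X ─ I ∣`: an element `x` of `X ─ I` is set aside, `I` is extended
    -- inside `X - x`, and `x` is added back only if it raises the rank of `X - x`.
    extend′ : ∀ n {I X} → ∣ X ─ I ∣ ≤ n → I ⊆ X → Independent I →
              ∃[ J ] I ⊆ J × J ⊆ X × Independent J × rk M X ≤ rk M J
    extend′ n {I} {X} ≤n I⊆X ind with nonempty? (X ─ I)
    ... | no empty = I , id , I⊆X , ind , rk-monotone M X I
      (sets (X ∷ I ∷ []) (λ X I → (X ─′ I , ⊥′) ∷ [] ⊢ X ⊆′ I)
        (subst (X ─ I ⊆_) (Empty-unique empty) id ∷ []))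
    extend′ zero {I} {X} ≤n I⊆X ind | yes (x , x∈) =
      contradiction (subst (_≤ 0) (∣⁅x⁆∣≡1 x) (≤-trans (p⊆q⇒∣p∣≤∣q∣ (⁅x⁆⊆ x∈)) ≤n)) 1+n≰n
    extend′ (suc n) {I} {X} ≤n I⊆X ind | yes (x , x∈)
      with extend′ n {I} {X - x} smaller
             (sets (I ∷ X ∷ ⁅ x ⁆ ∷ []) (λ I X x → (I , X) ∷ (x , X ─′ I) ∷ [] ⊢ I ⊆′ X ─′ x)
               (I⊆X ∷ ⁅x⁆⊆ x∈ ∷ [])) ind
      where
      smaller : ∣ (X - x) ─ I ∣ ≤ n
      smaller = linear (∣ (X - x) ─ I ∣ ∷ ∣ ⁅ x ⁆ ∣ ∷ ∣ X ─ I ∣ ∷ n ∷ [])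
        (λ y o z n → (y :+ o :≤ z) ∷ (con 1 :≤ o) ∷ (z :≤ con 1 :+ n) ∷ [] ⊢ y :≤ n)
        ( sets (I ∷ X ∷ ⁅ x ⁆ ∷ [])
            (λ I X x → (x , X ─′ I) ∷ [] ⊢ ∣ (X ─′ x) ─′ I ∣′ +′ ∣ x ∣′ ≤′ ∣ X ─′ I ∣′)
            (⁅x⁆⊆ x∈ ∷ [])
        ∷ ≤-reflexive (sym (∣⁅x⁆∣≡1 x)) ∷ ≤n ∷ [])
    ... | J , I⊆J , J⊆X-x , indJ , X-x≤J with rk M X ≤? rk M (X - x)
    ...   | yes X≤ = J , I⊆J , p─q⊆p X ⁅ x ⁆ ∘ J⊆X-x , indJ , ≤-trans X≤ X-x≤J
    ...   | no  X≰ = J ∪ ⁅ x ⁆ , p⊆p∪q ⁅ x ⁆ ∘ I⊆J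
      , sets (J ∷ X ∷ ⁅ x ⁆ ∷ I ∷ []) (λ J X x I → (J , X ─′ x) ∷ (x , X ─′ I) ∷ [] ⊢ J ∪′ x ⊆′ X)
          (J⊆X-x ∷ ⁅x⁆⊆ x∈ ∷ [])
      , linear (∣ J ∪ ⁅ x ⁆ ∣ ∷ ∣ J ∣ ∷ ∣ ⁅ x ⁆ ∣ ∷ rk M J ∷ rk M (J ∪ ⁅ x ⁆) ∷ [])
          (λ jx j o r rx → (jx :≤ j :+ o) ∷ (o :≤ con 1) ∷ (j :≤ r) ∷ (r :+ con 1 :≤ rx) ∷ [] ⊢ jx :≤ rx)
          ( sets (J ∷ ⁅ x ⁆ ∷ []) (λ J x → [] ⊢ ∣ J ∪′ x ∣′ ≤′ ∣ J ∣′ +′ ∣ x ∣′) []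
          ∷ ≤-reflexive (∣⁅x⁆∣≡1 x) ∷ indJ ∷ increases ∷ [])
      , linear (rk M X ∷ rk M (X - x) ∷ rk M ⁅ x ⁆ ∷ rk M J ∷ rk M (J ∪ ⁅ x ⁆) ∷ [])
          (λ X X-x o r rx → (X :≤ X-x :+ o) ∷ (o :≤ con 1) ∷ (X-x :≤ r) ∷ (r :+ con 1 :≤ rx) ∷ [] ⊢ X :≤ rx)
          ( rk-subadditive (sets (X ∷ ⁅ x ⁆ ∷ []) (λ X x → [] ⊢ X ⊆′ (X ─′ x) ∪′ x) [])
          ∷ ≤-trans (rk≤∣∣ ⁅ x ⁆) (≤-reflexive (∣⁅x⁆∣≡1 x)) ∷ X-x≤J ∷ increases ∷ [])
      where
      -- By submodularity `x` raises the rank of `J` at least as much as that of the larger set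
      -- `X - x`.
      increases : rk M J + 1 ≤ rk M (J ∪ ⁅ x ⁆)
      increases = linear (rk M X ∷ rk M (X - x) ∷ rk M J ∷ rk M (J ∪ ⁅ x ⁆) ∷ [])
        (λ X X-x j jx → (con 1 :+ X-x :≤ X) ∷ (X :+ j :≤ X-x :+ jx) ∷ [] ⊢ j :+ con 1 :≤ jx)
        ( ≰⇒> X≰
        ∷ rk-submodular-⊆
            (sets (X ∷ ⁅ x ⁆ ∷ J ∷ []) (λ X x J → [] ⊢ X ⊆′ (X ─′ x) ∪′ (J ∪′ x)) [])
            (sets (X ∷ ⁅ x ⁆ ∷ J ∷ []) (λ X x J → (J , X ─′ x) ∷ [] ⊢ J ⊆′ (X ─′ x) ∩′ (J ∪′ x))
              (J⊆X-x ∷ []))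
        ∷ [])

  abstract
    extend-independent : ∀ {I X} → I ⊆ X → Independent I →
                         ∃[ J ] I ⊆ J × J ⊆ X × Independent J × rk M X ≤ rk M J
    extend-independent = extend′ _ ≤-refl

  independent⇒basis : ∀ {B} → Independent B → rank M ≤ rk M B → IsBasis M B
  independent⇒basis {B} ind spans =
    independent⊆E ind , ≤-antisym (rk≤∣∣ B) ind , ≤-antisym (rk≤rank B) spans

  basis-⊇ : ∀ {I} → Independent I → ∃[ B ] I ⊆ B × IsBasis M B
  basis-⊇ ind with extend-independent (independent⊆E ind) ind
  ... | B , I⊆B , _ , indB , spans = B , I⊆B , independent⇒basis indB spans

  independent-subset : ∀ X → ∃[ J ] J ⊆ X × Independent J × rk M X ≤ rk M J
  independent-subset X with extend-independent {⊥} {X} ⊥⊆ (≤-trans (≤-reflexive (∣⊥∣≡0 u)) z≤n)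
  ... | J , _ , J⊆X , ind , spans = J , J⊆X , ind , spans

-- Uniform matroids and truncated ranks

⊓-submodular : ∀ m {a b c d} → b ≤ c → b ≤ d → a + b ≤ c + d → m ⊓ a + m ⊓ b ≤ m ⊓ c + m ⊓ d
⊓-submodular m {a} {b} {c} {d} b≤c b≤d a+b≤c+d with m ≤? c | m ≤? d
-- Here `m ⊓ c` is `m`, which bounds `m ⊓ a`, and `b ≤ d` settles the rest. If `m` is below neither
-- `c` nor `d`, the right-hand side is `c + d` itself.
... | yes m≤c | _ rewrite m≤n⇒m⊓n≡m m≤c = +-mono-≤ (m⊓n≤m m a) (⊓-monoʳ-≤ m b≤d)
... | no  _   | yes m≤d rewrite m≤n⇒m⊓n≡m m≤d =
  subst (_≤ m ⊓ c + m) (+-comm (m ⊓ b) (m ⊓ a)) (+-mono-≤ (⊓-monoʳ-≤ m b≤c) (m⊓n≤m m a))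
... | no  m≰c | no  m≰d rewrite m≥n⇒m⊓n≡n (≰⇒≥ m≰c) | m≥n⇒m⊓n≡n (≰⇒≥ m≰d) =
  ≤-trans (+-mono-≤ (m⊓n≤n m a) (m⊓n≤n m b)) a+b≤c+d

-- Besides serving `interpolate`, this provides the submodularity of truncated cardinalities that
-- relaxed ranks need.
uniform : ℕ → Subset u → Matroid u
uniform k Y = record
  { E             = Y
  ; rk            = λ X → k ⊓ ∣ X ∩ Y ∣
  ; rk-bounded    = λ X → m⊓n≤n k _
  ; rk-monotone   = λ X Z X⊆Z → ⊓-monoʳ-≤ k (p⊆q⇒∣p∣≤∣q∣
      (sets (X ∷ Z ∷ Y ∷ []) (λ X Z Y → (X , Z) ∷ [] ⊢ X ∩′ Y ⊆′ Z ∩′ Y) (X⊆Z ∷ [])))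
  ; rk-submodular = λ X Z → ⊓-submodular k
      (sets (X ∷ Z ∷ Y ∷ []) (λ X Z Y → [] ⊢ ∣ (X ∩′ Z) ∩′ Y ∣′ ≤′ ∣ X ∩′ Y ∣′) [])
      (sets (X ∷ Z ∷ Y ∷ []) (λ X Z Y → [] ⊢ ∣ (X ∩′ Z) ∩′ Y ∣′ ≤′ ∣ Z ∩′ Y ∣′) [])
      (sets (X ∷ Z ∷ Y ∷ []) (λ X Z Y → [] ⊢
        ∣ (X ∪′ Z) ∩′ Y ∣′ +′ ∣ (X ∩′ Z) ∩′ Y ∣′ ≤′ ∣ X ∩′ Y ∣′ +′ ∣ Z ∩′ Y ∣′) [])
  }

-- A k-set between X and Y is a basis of the uniform matroid on Y extending X.
abstract
  interpolate : ∀ k {X Y : Subset u} → X ⊆ Y → ∣ X ∣ ≤ k → k ≤ ∣ Y ∣ →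
                ∃[ S ] X ⊆ S × S ⊆ Y × ∣ S ∣ ≡ k
  interpolate k {X} {Y} X⊆Y ∣X∣≤k k≤∣Y∣
    with extend-independent (uniform k Y) X⊆Y
           (⊓-glb ∣X∣≤k (sets (X ∷ Y ∷ []) (λ X Y → (X , Y) ∷ [] ⊢ ∣ X ∣′ ≤′ ∣ X ∩′ Y ∣′) (X⊆Y ∷ [])))
  ... | S , X⊆S , S⊆Y , ind , spans = S , X⊆S , S⊆Y , ≤-antisym (≤-trans ind (m⊓n≤m k _))
    (≤-trans (⊓-glb ≤-refl (≤-trans k≤∣Y∣ (sets (Y ∷ []) (λ Y → [] ⊢ ∣ Y ∣′ ≤′ ∣ Y ∩′ Y ∣′) [])))
      (≤-trans spans (≤-trans (m⊓n≤n k _) (∣p∩q∣≤∣p∣ S Y))))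

∣─∣≤0⇒⊆ : {X Y : Subset u} → ∣ X ─ Y ∣ ≤ 0 → X ⊆ Y
∣─∣≤0⇒⊆ {Y = Y} ≤0 {x} x∈X with x ∈? Y
... | yes x∈Y = x∈Y
... | no  x∉Y = contradiction
  (subst (_≤ 0) (∣⁅x⁆∣≡1 x) (≤-trans (p⊆q⇒∣p∣≤∣q∣ (⁅x⁆⊆ (x∈p∧x∉q⇒x∈p─q x∈X x∉Y))) ≤0)) 1+n≰n

⊆⇒∣∣≤∣∩∣ : {X Y : Subset u} → X ⊆ Y → ∣ X ∣ ≤ ∣ X ∩ Y ∣
⊆⇒∣∣≤∣∩∣ {X = X} {Y} X⊆Y =
  sets (X ∷ Y ∷ []) (λ X Y → (X , Y) ∷ [] ⊢ ∣ X ∣′ ≤′ ∣ X ∩′ Y ∣′) (X⊆Y ∷ [])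

-- As `o < n`, the minimum can only be `m`. Bounds with a truncation are resolved in this way once
-- the other argument is known to be too large.
⊓≤⇒≤ : ∀ {m n o} → m ⊓ n ≤ o → o < n → m ≤ o
⊓≤⇒≤ {m} {n} m⊓n≤o o<n with ⊓-sel m n
... | inj₁ eq = respˡ _≤_ eq m⊓n≤o
... | inj₂ eq = contradiction (respˡ _≤_ eq m⊓n≤o) (<⇒≱ o<n)

∸-⊓ : ∀ k r c → (k ∸ r) ⊓ c ≡ k ⊓ (r + c) ∸ r
∸-⊓ k r c = sym (trans (∸-distribʳ-⊓ r k (r + c)) (cong ((k ∸ r) ⊓_) (m+n∸m≡n r c)))

-- Only a lower bound, since the reverse inequality holds in every matroid.
UniformRank : Matroid u → Set
UniformRank M = ∀ {X} → X ⊆ E M → rank M ⊓ ∣ X ∣ ≤ rk M X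

module _ (M : Matroid u) where

  isU⇒rank : ∀ {k n} → IsU k n M → rank M ≡ k
  isU⇒rank (_ , bases) with basis-⊇ M {⊥} (≤-trans (≤-reflexive (∣⊥∣≡0 u)) z≤n)
  ... | B , _ , basis@(_ , rk≡∣B∣ , rk≡rank) =
    trans (sym rk≡rank) (trans rk≡∣B∣ (proj₂ (Equivalence.to (bases B) basis)))

  -- A set of at most `k` elements extends to a `k`-set, which is a basis, and so is independent; a
  -- larger set contains a `k`-set and so spans.
  uniform⇒uniformRank : Uniform M → UniformRank M
  uniform⇒uniformRank (k , n , isU@(_ , bases)) {X} X⊆E with ∣ X ∣ ≤? k
  ... | yes ∣X∣≤k with interpolate k X⊆E ∣X∣≤k (respˡ _≤_ (isU⇒rank isU) (rk≤∣∣ M (E M)))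
  ...   | S , X⊆S , S⊆E , ∣S∣≡k =
    let _ , rk≡∣S∣ , _ = Equivalence.from (bases S) (S⊆E , ∣S∣≡k)
    in ≤-trans (m⊓n≤n _ _) (independent-⊆ M X⊆S (≤-reflexive (sym rk≡∣S∣)))
  uniform⇒uniformRank (k , n , isU@(_ , bases)) {X} X⊆E | no ∣X∣≰k
    with interpolate k {⊥} {X} ⊥⊆ (≤-trans (≤-reflexive (∣⊥∣≡0 u)) z≤n) (≰⇒≥ ∣X∣≰k)
  ... | S , _ , S⊆X , ∣S∣≡k =
    let _ , _ , rk≡rank = Equivalence.from (bases S) (X⊆E ∘ S⊆X , ∣S∣≡k)
    in ≤-trans (m⊓n≤m _ _) (subst (_≤ rk M X) rk≡rank (rk-monotone M _ _ S⊆X))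

  isU : ∀ {k} → rank M ≡ k → (∀ S → S ⊆ E M → ∣ S ∣ ≡ k → IsBasis M S) → IsU k (size M) M
  isU rank≡k bases = refl , λ S → mk⇔
    (λ (S⊆E , rk≡∣S∣ , rk≡rank) → S⊆E , trans (sym rk≡∣S∣) (trans rk≡rank rank≡k))
    (λ (S⊆E , ∣S∣≡k) → bases S S⊆E ∣S∣≡k)

  uniformRank⇒uniform : UniformRank M → Uniform M
  uniformRank⇒uniform uni = rank M , size M , isU refl λ S S⊆E ∣S∣≡rank →
    let rank≤rk = respˡ _≤_ (trans (cong (rank M ⊓_) ∣S∣≡rank) (⊓-idem _)) (uni S⊆E)
    in independent⇒basis M (respˡ _≤_ (sym ∣S∣≡rank) rank≤rk) rank≤rk

-- The bound for M / A is shifted by rk A, so that no truncated subtraction occurs.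
record StressedBounds (M : Matroid u) (A : Subset u) : Set where
  field
    ⊆E    : A ⊆ E M
    lower : ∀ {X} → X ⊆ A → rk M A ⊓ ∣ X ∣ ≤ rk M X
    upper : ∀ {X} → A ⊆ X → X ⊆ E M → rank M ⊓ (rk M A + ∣ X ─ A ∣) ≤ rk M X

-- Stressed subsets in terms of rank bounds

module _ (M : Matroid u) (A : Subset u) where

  stressed⇒bounds : Stressed M A → StressedBounds M A
  stressed⇒bounds (A⊆E , uni∣ , uni/) = record { ⊆E = A⊆E ; lower = lower ; upper = upper }
    where
    lower : ∀ {X} → X ⊆ A → rk M A ⊓ ∣ X ∣ ≤ rk M X
    lower {X} X⊆A = begin
      rk M A ⊓ ∣ X ∣
        ≤⟨ ⊓-monoˡ-≤ ∣ X ∣ (rk-monotone M _ _ (sets (A ∷ E M ∷ [])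
           (λ A E → (A , E) ∷ [] ⊢ A ⊆′ (E ∩′ A) ∩′ A) (A⊆E ∷ []))) ⟩
      rank (M ∣ᴹ A) ⊓ ∣ X ∣
        ≤⟨ uniform⇒uniformRank (M ∣ᴹ A) uni∣ (sets (X ∷ A ∷ E M ∷ [])
           (λ X A E → (X , A) ∷ (A , E) ∷ [] ⊢ X ⊆′ E ∩′ A)
           (X⊆A ∷ A⊆E ∷ [])) ⟩
      rk M (X ∩ A)
        ≤⟨ rk-monotone M _ _ (p∩q⊆p X A) ⟩
      rk M X ∎
      where open ≤-Reasoning
    upper : ∀ {X} → A ⊆ X → X ⊆ E M → rank M ⊓ (rk M A + ∣ X ─ A ∣) ≤ rk M X
    upper {X} A⊆X X⊆E = begin
      rank M ⊓ (rk M A + ∣ X ─ A ∣)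
        ≤⟨ ⊓-monoˡ-≤ _ (rk-monotone M _ _ (sets (A ∷ E M ∷ [])
           (λ A E → [] ⊢ E ⊆′ (E ─′ A) ∪′ A) [])) ⟩
      k/ ⊓ (rk M A + ∣ X ─ A ∣)
        ≤⟨ m≤n+m∸n _ (rk M A) ⟩
      rk M A + (k/ ⊓ (rk M A + ∣ X ─ A ∣) ∸ rk M A) ≡⟨ cong (rk M A +_) (∸-⊓ k/ (rk M A) _) ⟨
      rk M A + (rank (M /ᴹ A) ⊓ ∣ X ─ A ∣)
        ≤⟨ +-monoʳ-≤ (rk M A) (uniform⇒uniformRank (M /ᴹ A) uni/
           (sets (X ∷ A ∷ E M ∷ [])
           (λ X A E → (X , E) ∷ [] ⊢ X ─′ A ⊆′ E ─′ A) (X⊆E ∷ []))) ⟩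
      rk M A + (rk M ((X ─ A) ∪ A) ∸ rk M A)
        ≡⟨ m+[n∸m]≡n (rk-monotone M _ _ (q⊆p∪q (X ─ A) A)) ⟩
      rk M ((X ─ A) ∪ A)
        ≤⟨ rk-monotone M _ _ (sets (X ∷ A ∷ [])
           (λ X A → (A , X) ∷ [] ⊢ (X ─′ A) ∪′ A ⊆′ X) (A⊆X ∷ [])) ⟩
      rk M X ∎
      where
      open ≤-Reasoning
      -- This is `rank M` in the form in which it enters the rank of `M /ᴹ A`, before `rk M A` is
      -- subtracted.
      k/ = rk M ((E M ─ A) ∪ A)

  bounds⇒stressed : StressedBounds M A → Stressed M A
  bounds⇒stressed st = ⊆E , uniformRank⇒uniform (M ∣ᴹ A) uni∣ , uniformRank⇒uniform (M /ᴹ A) uni/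
    where
    open StressedBounds st
    uni∣ : UniformRank (M ∣ᴹ A)
    uni∣ {X} X⊆ = begin
      rank (M ∣ᴹ A) ⊓ ∣ X ∣
        ≤⟨ ⊓-mono-≤ (rk-monotone M _ _ (p∩q⊆q _ A)) (⊆⇒∣∣≤∣∩∣ (p∩q⊆q (E M) A ∘ X⊆)) ⟩
      rk M A ⊓ ∣ X ∩ A ∣
        ≤⟨ lower (p∩q⊆q X A) ⟩
      rk M (X ∩ A) ∎
      where open ≤-Reasoning
    uni/ : UniformRank (M /ᴹ A)
    uni/ {X} X⊆ = begin
      (k/ ∸ rk M A) ⊓ ∣ X ∣
        ≡⟨ ∸-⊓ k/ (rk M A) ∣ X ∣ ⟩
      k/ ⊓ (rk M A + ∣ X ∣) ∸ rk M A
        ≤⟨ ∸-monoˡ-≤ (rk M A) (⊓-mono-≤ (rk≤rank M _)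
           (+-monoʳ-≤ (rk M A) (sets (X ∷ A ∷ E M ∷ [])
           (λ X A E → (X , E ─′ A) ∷ [] ⊢ ∣ X ∣′ ≤′ ∣ X ∪′ A ─′ A ∣′)
           (X⊆ ∷ [])))) ⟩
      rank M ⊓ (rk M A + ∣ X ∪ A ─ A ∣) ∸ rk M A
        ≤⟨ ∸-monoˡ-≤ (rk M A) (upper (q⊆p∪q X A)
           (sets (X ∷ A ∷ E M ∷ [])
           (λ X A E → (X , E ─′ A) ∷ (A , E) ∷ [] ⊢ X ∪′ A ⊆′ E)
           (X⊆ ∷ ⊆E ∷ []))) ⟩
      rk M (X ∪ A) ∸ rk M A ∎
      where
      open ≤-Reasoning
      k/ = rk M ((E M ─ A) ∪ A)

-- Relaxation of a single stressed subset

module Relaxation (M : Matroid u) (A : Subset u) (st : StressedBounds M A) where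

  open StressedBounds st

  private
    k r : ℕ
    k = rank M
    r = rk M A

    Large : Subset u → Set
    Large X = r < ∣ X ∩ A ∣

    large? : ∀ X → Dec (Large X)
    large? X = r <? ∣ X ∩ A ∣

    large-⊆ : ∀ {X Y} → X ⊆ Y → Large X → Large Y
    large-⊆ {X} {Y} X⊆Y r< = ≤-trans r< (p⊆q⇒∣p∣≤∣q∣
      (sets (X ∷ Y ∷ A ∷ []) (λ X Y A → (X , Y) ∷ [] ⊢ X ∩′ A ⊆′ Y ∩′ A) (X⊆Y ∷ [])))

  -- The members of `Cover M A` are exactly the large `k`-subsets of `E M`, so truncated cardinality
  -- on large sets turns them into bases.
  relaxed-rk : Subset u → ℕ
  relaxed-rk X with large? X
  ... | yes _ = k ⊓ ∣ X ∩ E M ∣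
  ... | no  _ = rk M X

  large-rk : ∀ {X} → Large X → relaxed-rk X ≡ k ⊓ ∣ X ∩ E M ∣
  large-rk {X} large with large? X
  ... | yes _ = refl
  ... | no ¬p = contradiction large ¬p

  small-rk : ∀ {X} → ¬ Large X → relaxed-rk X ≡ rk M X
  small-rk {X} small with large? X
  ... | yes p = contradiction p small
  ... | no  _ = refl

  relaxed-rk≤ : ∀ X → relaxed-rk X ≤ k ⊓ ∣ X ∩ E M ∣
  relaxed-rk≤ X with large? X
  ... | yes _ = ≤-refl
  ... | no  _ = ⊓-glb (rk≤rank M X) (rk-bounded M X)

  rk≤relaxed-rk : ∀ X → rk M X ≤ relaxed-rk X
  rk≤relaxed-rk X with large? X
  ... | yes _ = ⊓-glb (rk≤rank M X) (rk-bounded M X)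
  ... | no  _ = ≤-refl

  private
    -- Submodularity for `X ∩ E M` enlarged by `A` and for `X ∩ A`: `upper` bounds the first rank
    -- from below and `lower` the second. `large-spans` and `small-independent` are the cases in
    -- which both minima can be evaluated.
    rk-bound : ∀ X → k ⊓ (r + ∣ X ∩ E M ─ A ∣) + r ⊓ ∣ X ∩ A ∣ ≤ rk M X + r
    rk-bound X = begin
      k ⊓ (r + ∣ X ∩ E M ─ A ∣) + r ⊓ ∣ X ∩ A ∣
        ≤⟨ +-mono-≤ (⊓-monoʳ-≤ k (+-monoʳ-≤ r (sets (X ∷ E M ∷ A ∷ [])
             (λ X E A → [] ⊢ ∣ X ∩′ E ─′ A ∣′ ≤′ ∣ (X ∩′ E) ∪′ A ─′ A ∣′) [])))
             (lower (p∩q⊆q X A)) ⟩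
      k ⊓ (r + ∣ (X ∩ E M) ∪ A ─ A ∣) + rk M (X ∩ A)
        ≤⟨ +-monoˡ-≤ _ (upper (q⊆p∪q (X ∩ E M) A)
             (sets (X ∷ E M ∷ A ∷ []) (λ X E A → (A , E) ∷ [] ⊢ (X ∩′ E) ∪′ A ⊆′ E) (⊆E ∷ []))) ⟩
      rk M ((X ∩ E M) ∪ A) + rk M (X ∩ A)
        ≤⟨ rk-submodular-⊆ M
             (sets (X ∷ E M ∷ A ∷ []) (λ X E A → [] ⊢ (X ∩′ E) ∪′ A ⊆′ X ∪′ A) []) id ⟩
      rk M X + r ∎
      where open ≤-Reasoning

    large-spans : ∀ {X} → Large X → k ≤ r + ∣ X ∩ E M ─ A ∣ → k ≤ rk M X
    large-spans {X} r< k≤ = +-cancelʳ-≤ r k (rk M X)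
      (subst₂ (λ a b → a + b ≤ rk M X + r) (m≤n⇒m⊓n≡m k≤) (m≤n⇒m⊓n≡m (<⇒≤ r<)) (rk-bound X))

    small-independent : ∀ {X} → ¬ Large X → r + ∣ X ∩ E M ─ A ∣ ≤ k → ∣ X ∩ E M ∣ ≤ rk M X
    small-independent {X} small ≤k =
      linear (∣ X ∩ E M ∣ ∷ ∣ X ∩ A ∣ ∷ ∣ X ∩ E M ─ A ∣ ∷ r ∷ rk M X ∷ [])
        (λ e a d r x → (r :+ d :+ a :≤ x :+ r) ∷ (e :≤ a :+ d) ∷ [] ⊢ e :≤ x)
        ( subst₂ (λ a b → a + b ≤ rk M X + r) (m≥n⇒m⊓n≡n ≤k) (m≥n⇒m⊓n≡n (≮⇒≥ small)) (rk-bound X)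
        ∷ sets (X ∷ E M ∷ A ∷ [])
            (λ X E A → [] ⊢ ∣ X ∩′ E ∣′ ≤′ ∣ X ∩′ A ∣′ +′ ∣ X ∩′ E ─′ A ∣′) []
        ∷ [])

  relaxed-rk-monotone : ∀ X Y → X ⊆ Y → relaxed-rk X ≤ relaxed-rk Y
  relaxed-rk-monotone X Y X⊆Y with large? Y
  ... | yes _ = ≤-trans (relaxed-rk≤ X) (⊓-monoʳ-≤ k (p⊆q⇒∣p∣≤∣q∣
          (sets (X ∷ Y ∷ E M ∷ []) (λ X Y A → (X , Y) ∷ [] ⊢ X ∩′ A ⊆′ Y ∩′ A) (X⊆Y ∷ []))))
  ... | no  small = subst (_≤ rk M Y) (sym (small-rk (small ∘ large-⊆ X⊆Y))) (rk-monotone M X Y X⊆Y)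

  -- For each pair X, Y one of two reasons applies: either the relaxation leaves the
  -- ranks of X ∪ Y and X ∩ Y alone, or it makes X and Y uniform.
  relaxed-rk-submodular : ∀ X Y → relaxed-rk (X ∪ Y) + relaxed-rk (X ∩ Y) ≤ relaxed-rk X + relaxed-rk Y
  relaxed-rk-submodular X Y =
    cases (large? (X ∪ Y)) (large? (X ∩ Y)) (k ≤? r + ∣ (X ∪ Y) ∩ E M ─ A ∣)
    where
    unchanged : relaxed-rk (X ∪ Y) ≤ rk M (X ∪ Y) → ¬ Large (X ∩ Y) →
                relaxed-rk (X ∪ Y) + relaxed-rk (X ∩ Y) ≤ relaxed-rk X + relaxed-rk Y
    unchanged ≤rk small = begin
      relaxed-rk (X ∪ Y) + relaxed-rk (X ∩ Y) ≤⟨ +-mono-≤ ≤rk (≤-reflexive (small-rk small)) ⟩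
      rk M (X ∪ Y) + rk M (X ∩ Y)             ≤⟨ rk-submodular M X Y ⟩
      rk M X + rk M Y                         ≤⟨ +-mono-≤ (rk≤relaxed-rk X) (rk≤relaxed-rk Y) ⟩
      relaxed-rk X + relaxed-rk Y ∎
      where open ≤-Reasoning

    maximal : k ⊓ ∣ X ∩ E M ∣ ≤ relaxed-rk X → k ⊓ ∣ Y ∩ E M ∣ ≤ relaxed-rk Y →
              relaxed-rk (X ∪ Y) + relaxed-rk (X ∩ Y) ≤ relaxed-rk X + relaxed-rk Y
    maximal ≤X ≤Y = begin
      relaxed-rk (X ∪ Y) + relaxed-rk (X ∩ Y)               ≤⟨ +-mono-≤ (relaxed-rk≤ (X ∪ Y)) (relaxed-rk≤ (X ∩ Y)) ⟩
      k ⊓ ∣ (X ∪ Y) ∩ E M ∣ + k ⊓ ∣ (X ∩ Y) ∩ E M ∣         ≤⟨ rk-submodular (uniform k (E M)) X Y ⟩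
      k ⊓ ∣ X ∩ E M ∣ + k ⊓ ∣ Y ∩ E M ∣                     ≤⟨ +-mono-≤ ≤X ≤Y ⟩
      relaxed-rk X + relaxed-rk Y ∎
      where open ≤-Reasoning

    maximal-⊆ : ∀ {Z} → Z ⊆ X ∪ Y → ¬ (k ≤ r + ∣ (X ∪ Y) ∩ E M ─ A ∣) → k ⊓ ∣ Z ∩ E M ∣ ≤ relaxed-rk Z
    maximal-⊆ {Z} Z⊆ k≰ with large? Z
    ... | yes _     = ≤-refl
    ... | no  small = ≤-trans (m⊓n≤n k _) (small-independent small (≤-trans
      (+-monoʳ-≤ r (sets (Z ∷ X ∪ Y ∷ E M ∷ A ∷ [])
        (λ Z W E A → (Z , W) ∷ [] ⊢ ∣ Z ∩′ E ─′ A ∣′ ≤′ ∣ W ∩′ E ─′ A ∣′) (Z⊆ ∷ [])))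
      (≰⇒≥ k≰)))

    cases : Dec (Large (X ∪ Y)) → Dec (Large (X ∩ Y)) → Dec (k ≤ r + ∣ (X ∪ Y) ∩ E M ─ A ∣) →
            relaxed-rk (X ∪ Y) + relaxed-rk (X ∩ Y) ≤ relaxed-rk X + relaxed-rk Y
    cases (no small) _ _ = unchanged (≤-reflexive (small-rk small))
      (small ∘ large-⊆ (p⊆p∪q Y ∘ p∩q⊆p X Y))
    cases (yes _) (yes large) _ = maximal
      (≤-reflexive (sym (large-rk {X} (large-⊆ (p∩q⊆p X Y) large))))
      (≤-reflexive (sym (large-rk {Y} (large-⊆ (p∩q⊆q X Y) large))))
    -- By `large-spans` the union already has rank `k` in `M`, so relaxing cannot raise its rank.
    cases (yes large) (no small) (yes k≤) = unchanged
      (≤-trans (relaxed-rk≤ (X ∪ Y)) (≤-trans (m⊓n≤m k _) (large-spans large k≤))) small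
    -- The union has so few elements outside `A` that the part in `E M` of each of its small subsets
    -- is independent; large subsets have uniform rank by definition.
    cases (yes _) (no _) (no k≰) =
      maximal (maximal-⊆ (p⊆p∪q Y) k≰) (maximal-⊆ (q⊆p∪q X Y) k≰)

  relaxation : Matroid u
  relaxation = record
    { E             = E M
    ; rk            = relaxed-rk
    ; rk-bounded    = λ X → ≤-trans (relaxed-rk≤ X) (m⊓n≤n k _)
    ; rk-monotone   = relaxed-rk-monotone
    ; rk-submodular = relaxed-rk-submodular
    }

  relaxation-rank : rank relaxation ≡ k
  relaxation-rank = ≤-antisym (≤-trans (relaxed-rk≤ (E M)) (m⊓n≤m k _)) (rk≤relaxed-rk (E M))

  relaxation-isRel : IsRel M A relaxation
  relaxation-isRel = record
    { stressed = bounds⇒stressed M A st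
    ; ground   = refl
    ; bases    = λ S → mk⇔ to [ fromBasis , fromCover ]′
    }
    where
    to : ∀ {S} → IsBasis relaxation S → IsBasis M S ⊎ Cover M A S
    to {S} (S⊆E , rk≡∣S∣ , rk≡rank) with large? S
    ... | yes r< = inj₂ (S⊆E , trans (sym rk≡∣S∣) (trans rk≡rank relaxation-rank)
                            , respˡ _≤_ (+-comm 1 r) r<)
    ... | no  _  = inj₁ (S⊆E , rk≡∣S∣ , trans rk≡rank relaxation-rank)
    fromBasis : ∀ {S} → IsBasis M S → IsBasis relaxation S
    fromBasis {S} (S⊆E , rk≡∣S∣ , rk≡rank) = independent⇒basis relaxation
      (respˡ _≤_ rk≡∣S∣ (rk≤relaxed-rk S))
      (respˡ _≤_ (trans rk≡rank (sym relaxation-rank)) (rk≤relaxed-rk S))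
    fromCover : ∀ {S} → Cover M A S → IsBasis relaxation S
    fromCover {S} (S⊆E , ∣S∣≡k , r+1≤) = independent⇒basis relaxation
      (respˡ _≤_ (sym ∣S∣≡k) k≤) (respˡ _≤_ (sym relaxation-rank) k≤)
      where
      k≤ : k ≤ relaxed-rk S
      k≤ = subst (k ≤_) (sym (large-rk {S} (respˡ _≤_ (+-comm r 1) r+1≤)))
        (⊓-glb ≤-refl (respˡ _≤_ ∣S∣≡k (⊆⇒∣∣≤∣∩∣ S⊆E)))

-- Chains of relaxations

record Relaxable (M : Matroid u) (A : Subset u) : Set where
  field
    bounds    : StressedBounds M A
    dependent : rk M A < ∣ A ∣
    proper    : rk M A < rank M
  open StressedBounds bounds public

module _ (M : Matroid u) where

  open Relaxable

  -- `S ∩ A` has more than `rk M A` elements and lies both in `A` and in the set `S` of size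
  -- `rank M`. These two strict inequalities are kept instead of the cover because they pass easily
  -- to relaxations.
  cover⇒relaxable : ∀ {A} → Stressed M A → ∃ (Cover M A) → Relaxable M A
  cover⇒relaxable {A} st (S , _ , ∣S∣≡rank , r+1≤) = record
    { bounds    = stressed⇒bounds M A st
    ; dependent = ≤-trans r< (∣p∩q∣≤∣q∣ S A)
    ; proper    = respʳ _≤_ ∣S∣≡rank (≤-trans r< (∣p∩q∣≤∣p∣ S A))
    }
    where r< = respˡ _≤_ (+-comm (rk M A) 1) r+1≤

  -- As `rk M A < rank M`, the minimum in `upper` for `X ∪ A` is its second argument, which leaves
  -- no element in `X ─ A`.
  relaxable-closed : ∀ {A X} → Relaxable M A → X ⊆ E M → rk M (X ∪ A) ≤ rk M A → X ⊆ A
  relaxable-closed {A} {X} rel X⊆E ≤r = ∣─∣≤0⇒⊆ (+-cancelˡ-≤ (rk M A) _ _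
    (respʳ _≤_ (sym (+-identityʳ _)) (⊓≤⇒≤
      (subst (_≤ rk M A) (⊓-comm (rank M) (rk M A + ∣ X ─ A ∣)) (≤-trans
        (⊓-monoʳ-≤ (rank M) (+-monoʳ-≤ (rk M A)
          (sets (X ∷ A ∷ []) (λ X A → [] ⊢ ∣ X ─′ A ∣′ ≤′ ∣ X ∪′ A ─′ A ∣′) [])))
        (≤-trans (upper rel (q⊆p∪q X A)
          (sets (X ∷ A ∷ E M ∷ []) (λ X A E → (X , E) ∷ (A , E) ∷ [] ⊢ X ∪′ A ⊆′ E)
            (X⊆E ∷ ⊆E rel ∷ [])))
        ≤r)))
      (proper rel))))

  -- If A ∩ B is dependent in A then it spans both A and B, which are closed.
  relaxable-∩ : ∀ {A B} → Relaxable M A → Relaxable M B → A ≢ B → ∣ B ∩ A ∣ ≤ rk M A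
  relaxable-∩ {A} {B} relA relB A≢B with ∣ B ∩ A ∣ ≤? rk M A
  ... | yes ≤r = ≤r
  ... | no  ≰r = contradiction (⊆-antisym
      (relaxable-closed relB (⊆E relA) (linear ρ
        (λ x i a b → (x :+ i :≤ b :+ a) ∷ (a :≤ i) ∷ [] ⊢ x :≤ b) (A∪B≤ ∷ A≤ ∷ [])))
      (relaxable-closed relA (⊆E relB) (linear ρ′
        (λ x i a b → (x :+ i :≤ b :+ a) ∷ (b :≤ i) ∷ [] ⊢ x :≤ a) (rk-submodular M B A ∷ B≤ ∷ []))))
      A≢B
    where
    ρ  = rk M (A ∪ B) ∷ rk M (B ∩ A) ∷ rk M A ∷ rk M B ∷ []
    ρ′ = rk M (B ∪ A) ∷ rk M (B ∩ A) ∷ rk M A ∷ rk M B ∷ []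
    A∪B≤ : rk M (A ∪ B) + rk M (B ∩ A) ≤ rk M B + rk M A
    A∪B≤ = rk-submodular-⊆ M (sets (A ∷ B ∷ []) (λ A B → [] ⊢ A ∪′ B ⊆′ B ∪′ A) []) id
    A≤ : rk M A ≤ rk M (B ∩ A)
    A≤ = subst (_≤ rk M (B ∩ A)) (m≤n⇒m⊓n≡m (≰⇒≥ ≰r)) (lower relA (p∩q⊆q B A))
    B≤ : rk M B ≤ rk M (B ∩ A)
    -- `∣ B ∩ A ∣` exceeds `rk M A`, hence also `rk M (B ∩ A)`, so the minimum in `lower relB` is
    -- `rk M B`.
    B≤ = ⊓≤⇒≤ (lower relB (p∩q⊆p B A)) (≤-<-trans (rk-monotone M _ _ (p∩q⊆q B A)) (≰⇒> ≰r))

  module _ {A B} (relA : Relaxable M A) (relB : Relaxable M B) (A≢B : A ≢ B) where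

    open Relaxation M A (bounds relA)

    relaxed-rk-other : relaxed-rk B ≡ rk M B
    relaxed-rk-other = small-rk (≤⇒≯ (relaxable-∩ relA relB A≢B))

    -- Relaxing `A` changes neither the rank of `B` nor that of the matroid and decreases no rank,
    -- so the lower bounds for `B` persist.
    relaxable-relaxation : Relaxable relaxation B
    relaxable-relaxation = record
      { bounds    = record
        { ⊆E    = ⊆E relB
        ; lower = λ {X} X⊆B → ≤-trans
            (≤-trans (⊓-monoˡ-≤ ∣ X ∣ (≤-reflexive relaxed-rk-other)) (lower relB X⊆B))
            (rk≤relaxed-rk X)
        ; upper = λ {X} B⊆X X⊆E → ≤-trans
            (≤-trans (⊓-mono-≤ (≤-reflexive relaxation-rank)
                (+-monoˡ-≤ ∣ X ─ B ∣ (≤-reflexive relaxed-rk-other)))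
              (upper relB B⊆X X⊆E))
            (rk≤relaxed-rk X)
        }
      ; dependent = subst (_< ∣ B ∣) (sym relaxed-rk-other) (dependent relB)
      ; proper    = subst₂ _<_ (sym relaxed-rk-other) (sym relaxation-rank) (proper relB)
      }

    cover-relaxation : ∀ {S} → Cover M B S → Cover relaxation B S
    cover-relaxation (S⊆E , ∣S∣≡k , r+1≤) =
      S⊆E , trans ∣S∣≡k (sym relaxation-rank) , subst (λ r → r + 1 ≤ _) (sym relaxed-rk-other) r+1≤

record Relaxed (M : Matroid u) (Fs : List (Subset u)) : Set where
  field
    N       : Matroid u
    relaxes : Relaxes M Fs N
    ground  : E N ≡ E M
    rank-≡  : rank N ≡ rank M
    bases   : ∀ {S} → IsBasis M S → IsBasis N S
    covers  : ∀ {F S} → F List.∈ Fs → Cover M F S → IsBasis N S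

-- The head is relaxed first. The remaining sets differ from it, so they stay relaxable, and their
-- covers in `M` are still covers afterwards.
relax-all : ∀ {M : Matroid u} {Fs} → Unique Fs → All (Relaxable M) Fs → Relaxed M Fs
relax-all {M = M} [] [] = record
  { N = M ; relaxes = [] ; ground = refl ; rank-≡ = refl ; bases = id ; covers = λ () }
relax-all {M = M} {F ∷ _} (F∉ ∷ unique) (relF ∷ rels) = record
  { N       = N
  ; relaxes = relaxation-isRel ∷ relaxes
  ; ground  = ground
  ; rank-≡  = trans rank-≡ relaxation-rank
  ; bases   = λ {S} basis → bases (Equivalence.from (IsRel.bases relaxation-isRel S) (inj₁ basis))
  ; covers  = covers′
  }
  where
  open Relaxation M F (Relaxable.bounds relF)
  open Relaxed (relax-all unique
    (All.tabulate (λ F∈ → relaxable-relaxation M relF (All.lookup rels F∈) (All.lookup F∉ F∈))))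
  covers′ : ∀ {G S} → G List.∈ F ∷ _ → Cover M G S → IsBasis N S
  covers′ {S = S} (here refl) cover = bases (Equivalence.from (IsRel.bases relaxation-isRel S) (inj₂ cover))
  covers′         (there G∈)  cover = covers G∈
    (cover-relaxation M relF (All.lookup rels G∈) (All.lookup F∉ G∈) cover)

module _ {M : Matroid u} {Fs : List (Subset u)} (lists : ListsStressed M Fs) where

  open ListsStressed lists

  relaxes-to-uniform :
    (∀ {S} → S ⊆ E M → ∣ S ∣ ≡ rank M → rank M ≤ rk M S ⊎ ∃[ F ] Stressed M F × Cover M F S) →
    ∃[ N ] Relaxes M Fs N × IsU (rank M) (size M) N
  relaxes-to-uniform covered = N , relaxes , cong ∣_∣ ground , proj₂ (isU N rank-≡ basis)
    where
    relaxable : ∀ {F} → F List.∈ Fs → Relaxable M F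
    relaxable F∈ = let stressed , nonempty = Equivalence.to (complete _) F∈
                   in cover⇒relaxable M stressed nonempty
    open Relaxed (relax-all unique (All.tabulate relaxable))
    basis : ∀ S → S ⊆ E N → ∣ S ∣ ≡ rank M → IsBasis N S
    basis S S⊆E ∣S∣≡rank with covered (subst (S ⊆_) ground S⊆E) ∣S∣≡rank
    ... | inj₁ rank≤rk = bases (independent⇒basis M (respˡ _≤_ (sym ∣S∣≡rank) rank≤rk) rank≤rk)
    ... | inj₂ (F , stressed , cover) = covers (Equivalence.from (complete F) (stressed , S , cover)) cover

-- Connectedness in terms of separators

nonempty-⊆ : {X Y : Subset u} → X ⊆ Y → Nonempty X → Nonempty Y
nonempty-⊆ X⊆Y (x , x∈X) = x , X⊆Y x∈X

nonempty⇒0< : {X : Subset u} → Nonempty X → 0 < ∣ X ∣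
nonempty⇒0< (x , x∈X) = respˡ _≤_ (∣⁅x⁆∣≡1 x) (p⊆q⇒∣p∣≤∣q∣ (⁅x⁆⊆ x∈X))

empty⇒⊆⊥ : {X : Subset u} → Empty X → X ⊆ ⊥
empty⇒⊆⊥ {X = X} empty x∈X = contradiction (_ , x∈X) empty

0<⇒nonempty : {X : Subset u} → 0 < ∣ X ∣ → Nonempty X
0<⇒nonempty {u} {X} 0< with nonempty? X
... | yes nonempty = nonempty
... | no  empty    = contradiction 0<
  (≤⇒≯ (≤-trans (p⊆q⇒∣p∣≤∣q∣ (empty⇒⊆⊥ empty)) (≤-reflexive (∣⊥∣≡0 u))))

-- A separation of `M ∣ᴹ X` expressed through the rank function of `M`. Only the inequality that
-- subadditivity does not give is recorded.
record Separator (M : Matroid u) (X D : Subset u) : Set where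
  field
    ⊆X        : D ⊆ X
    nonempty  : Nonempty D
    nonempty′ : Nonempty (X ─ D)
    splits    : rk M D + rk M (X ─ D) ≤ rk M X

module _ (M : Matroid u) where

  -- Submodularity is applied to `X` and `D`, and then to `X ∪ D` and `Y ─ D`, whose union contains
  -- `Y` and whose intersection contains `X ─ D`.
  split-⊆ : ∀ {X Y D} → rk M D + rk M (Y ─ D) ≤ rk M Y → X ⊆ Y → rk M (X ∩ D) + rk M (X ─ D) ≤ rk M X
  split-⊆ {X} {Y} {D} splits X⊆Y =
    linear (rk M (X ∩ D) ∷ rk M (X ─ D) ∷ rk M X ∷ rk M D ∷ rk M (Y ─ D) ∷ rk M Y ∷ rk M (X ∪ D) ∷ [])
      (λ i d x D Y─D Y u → (D :+ Y─D :≤ Y) ∷ (u :+ i :≤ x :+ D) ∷ (Y :+ d :≤ u :+ Y─D) ∷ [] ⊢ i :+ d :≤ x)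
      ( splits
      ∷ rk-submodular M X D
      ∷ rk-submodular-⊆ M
          (sets (X ∷ Y ∷ D ∷ []) (λ X Y D → [] ⊢ Y ⊆′ (X ∪′ D) ∪′ (Y ─′ D)) [])
          (sets (X ∷ Y ∷ D ∷ []) (λ X Y D → (X , Y) ∷ [] ⊢ X ─′ D ⊆′ (X ∪′ D) ∩′ (Y ─′ D)) (X⊆Y ∷ []))
      ∷ [])

  separator-comm : ∀ {X D} → Separator M X D → Separator M X (X ─ D)
  separator-comm {X} {D} sep = record
    { ⊆X        = p─q⊆p X D
    ; nonempty  = nonempty′
    ; nonempty′ = nonempty-⊆
        (sets (D ∷ X ∷ []) (λ D X → (D , X) ∷ [] ⊢ D ⊆′ X ─′ (X ─′ D)) (⊆X ∷ [])) nonempty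
    ; splits    = linear (rk M (X ─ D) ∷ rk M (X ─ (X ─ D)) ∷ rk M D ∷ rk M X ∷ [])
        (λ x y d k → (d :+ x :≤ k) ∷ (y :≤ d) ∷ [] ⊢ x :+ y :≤ k)
        ( splits
        ∷ rk-monotone M _ _ (sets (D ∷ X ∷ []) (λ D X → [] ⊢ X ─′ (X ─′ D) ⊆′ D) [])
        ∷ [])
    }
    where open Separator sep

  splits⇒directSum : ∀ {D} → rk M D + rk M (E M ─ D) ≤ rank M → IsDirectSum M (M ∣ᴹ D) (M ∣ᴹ (E M ─ D))
  splits⇒directSum {D} splits = record
    { disjoint = λ (x , x∈) → ∉⊥ (sets (E M ∷ D ∷ [])
        (λ E D → [] ⊢ (E ∩′ D) ∩′ (E ∩′ (E ─′ D)) ⊆′ ⊥′) [] x∈)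
    ; ground   = ⊆-antisym
        (sets (E M ∷ D ∷ []) (λ E D → [] ⊢ E ⊆′ (E ∩′ D) ∪′ (E ∩′ (E ─′ D))) [])
        (sets (E M ∷ D ∷ []) (λ E D → [] ⊢ (E ∩′ D) ∪′ (E ∩′ (E ─′ D)) ⊆′ E) [])
    ; rk-sum   = λ X → ≤-antisym
        (≤-trans (rk-∩E M X) (rk-subadditive M (sets (X ∷ E M ∷ D ∷ [])
          (λ X E D → [] ⊢ X ∩′ E ⊆′ ((X ∩′ (E ∩′ D)) ∩′ D) ∪′ ((X ∩′ (E ∩′ (E ─′ D))) ∩′ (E ─′ D))) [])))
        (≤-trans (+-mono-≤
            (rk-monotone M _ _ (sets (X ∷ E M ∷ D ∷ [])
              (λ X E D → [] ⊢ (X ∩′ (E ∩′ D)) ∩′ D ⊆′ (X ∩′ E) ∩′ D) []))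
            (rk-monotone M _ _ (sets (X ∷ E M ∷ D ∷ [])
              (λ X E D → [] ⊢ (X ∩′ (E ∩′ (E ─′ D))) ∩′ (E ─′ D) ⊆′ (X ∩′ E) ─′ D) [])))
          (≤-trans (split-⊆ splits (p∩q⊆q X (E M))) (rk-monotone M _ _ (p∩q⊆p X (E M)))))
    }

  module _ {M₁ M₂ : Matroid u} (sum : IsDirectSum M M₁ M₂) where

    open IsDirectSum sum

    directSum-comm : IsDirectSum M M₂ M₁
    directSum-comm = record
      { disjoint = λ (x , x∈) → disjoint (x , sets (E M₁ ∷ E M₂ ∷ [])
          (λ A B → [] ⊢ B ∩′ A ⊆′ A ∩′ B) [] x∈)
      ; ground   = trans ground (∪-comm (E M₁) (E M₂))
      ; rk-sum   = λ X → trans (rk-sum X) (+-comm (rk M₁ _) _)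
      }

    directSum-⊆E : E M₁ ⊆ E M
    directSum-⊆E = subst (E M₁ ⊆_) (sym ground) (p⊆p∪q (E M₂))

    directSum-∩⊆⊥ : E M₁ ∩ E M₂ ⊆ ⊥
    directSum-∩⊆⊥ = empty⇒⊆⊥ disjoint

    rk-summand : ∀ {X} → X ∩ E M₂ ⊆ ⊥ → rk M X ≤ rk M₁ (X ∩ E M₁)
    rk-summand {X} X⊆⊥ = linear (rk M X ∷ rk M₁ (X ∩ E M₁) ∷ rk M₂ (X ∩ E M₂) ∷ [])
      (λ x a b → (x :≤ a :+ b) ∷ (b :≤ con 0) ∷ [] ⊢ x :≤ a)
      ( ≤-reflexive (rk-sum X)
      ∷ ≤-trans (rk≤∣∣ M₂ (X ∩ E M₂)) (≤-trans (p⊆q⇒∣p∣≤∣q∣ X⊆⊥) (≤-reflexive (∣⊥∣≡0 u)))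
      ∷ [])

  directSum⇒splits : ∀ {M₁ M₂} → IsDirectSum M M₁ M₂ → rk M (E M₁) + rk M (E M ─ E M₁) ≤ rank M
  directSum⇒splits {M₁} {M₂} sum = begin
    rk M (E M₁) + rk M (E M ─ E M₁)
      ≤⟨ +-mono-≤ (rk-summand sum (directSum-∩⊆⊥ sum))
          (rk-summand (directSum-comm sum) (sets (E M ∷ E M₁ ∷ []) (λ E A → [] ⊢ (E ─′ A) ∩′ A ⊆′ ⊥′) [])) ⟩
    rk M₁ (E M₁ ∩ E M₁) + rk M₂ ((E M ─ E M₁) ∩ E M₂)
      ≤⟨ +-mono-≤ (rk-monotone M₁ _ _ (sets (E M ∷ E M₁ ∷ []) (λ E A → (A , E) ∷ [] ⊢ A ∩′ A ⊆′ E ∩′ A)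
                    (directSum-⊆E sum ∷ [])))
                  (rk-monotone M₂ _ _ (sets (E M ∷ E M₁ ∷ E M₂ ∷ [])
                    (λ E A B → [] ⊢ (E ─′ A) ∩′ B ⊆′ E ∩′ B) [])) ⟩
    rk M₁ (E M ∩ E M₁) + rk M₂ (E M ∩ E M₂)
      ≡⟨ rk-sum (E M) ⟨
    rank M ∎
    where
    open IsDirectSum sum
    open ≤-Reasoning

  separator⇒¬connected : ∀ {D} → Separator M (E M) D → ¬ Connected M
  separator⇒¬connected {D} sep connected = connected
    ( M ∣ᴹ D , M ∣ᴹ (E M ─ D)
    , nonempty-⊆ (sets (E M ∷ D ∷ []) (λ E D → (D , E) ∷ [] ⊢ D ⊆′ E ∩′ D) (⊆X ∷ [])) nonempty
    , nonempty-⊆ (sets (E M ∷ D ∷ []) (λ E D → [] ⊢ E ─′ D ⊆′ E ∩′ (E ─′ D)) []) nonempty′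
    , splits⇒directSum splits)
    where open Separator sep

  noSeparator⇒connected : (∀ {D} → ¬ Separator M (E M) D) → Connected M
  noSeparator⇒connected none (M₁ , M₂ , nonempty₁ , nonempty₂ , sum) = none {E M₁} (record
    { ⊆X        = directSum-⊆E sum
    ; nonempty  = nonempty₁
    ; nonempty′ = nonempty-⊆ (sets (E M ∷ E M₁ ∷ E M₂ ∷ [])
        (λ E A B → (A ∩′ B , ⊥′) ∷ (B , E) ∷ [] ⊢ B ⊆′ E ─′ A)
        (directSum-∩⊆⊥ sum ∷ directSum-⊆E (directSum-comm sum) ∷ [])) nonempty₂
    ; splits    = directSum⇒splits sum
    })

  -- `Connected` is a negated statement; a search through all subsets makes it decidable, with a
  -- separator as the alternative.
  separator? : ∀ X → Dec (∃ (Separator M X))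
  separator? X = anySubset? λ D → map′
    (λ (p , q , r , s) → record { ⊆X = p ; nonempty = q ; nonempty′ = r ; splits = s })
    (λ sep → let open Separator sep in (λ {x} → ⊆X {x}) , nonempty , nonempty′ , splits)
    (D ⊆? X ×-dec nonempty? D ×-dec nonempty? (X ─ D) ×-dec (rk M D + rk M (X ─ D) ≤? rk M X))

  connected? : Connected M ⊎ ∃ (Separator M (E M))
  connected? with separator? (E M)
  ... | yes sep = inj₂ sep
  ... | no none = inj₁ (noSeparator⇒connected λ sep → none (_ , sep))

-- Separators of restrictions and contractions

module _ (M : Matroid u) {F : Subset u} (F⊆E : F ⊆ E M) where

  restriction-separator : ∀ {D} → Separator (M ∣ᴹ F) (E M ∩ F) D → Separator M F D
  restriction-separator {D} sep = record
    { ⊆X        = p∩q⊆q (E M) F ∘ ⊆X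
    ; nonempty  = nonempty
    ; nonempty′ = nonempty-⊆
        (sets (E M ∷ F ∷ D ∷ []) (λ E F D → [] ⊢ E ∩′ F ─′ D ⊆′ F ─′ D) []) nonempty′
    ; splits    = begin
        rk M D + rk M (F ─ D)
          ≤⟨ +-mono-≤
              (rk-monotone M _ _ (sets (E M ∷ F ∷ D ∷ []) (λ E F D → (D , E ∩′ F) ∷ [] ⊢ D ⊆′ D ∩′ F) (⊆X ∷ [])))
              (rk-monotone M _ _ (sets (E M ∷ F ∷ D ∷ [])
                (λ E F D → (F , E) ∷ [] ⊢ F ─′ D ⊆′ (E ∩′ F ─′ D) ∩′ F) (F⊆E ∷ []))) ⟩
        rk M (D ∩ F) + rk M ((E M ∩ F ─ D) ∩ F) ≤⟨ splits ⟩
        rk M ((E M ∩ F) ∩ F)                    ≤⟨ rk-monotone M _ _ (p∩q⊆q (E M ∩ F) F) ⟩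
        rk M F                                  ∎
    }
    where
    open Separator sep
    open ≤-Reasoning

  separator-restriction : ∀ {D} → Separator M F D → Separator (M ∣ᴹ F) (E M ∩ F) D
  separator-restriction {D} sep = record
    { ⊆X        = sets (E M ∷ F ∷ D ∷ []) (λ E F D → (F , E) ∷ (D , F) ∷ [] ⊢ D ⊆′ E ∩′ F) (F⊆E ∷ ⊆X ∷ [])
    ; nonempty  = nonempty
    ; nonempty′ = nonempty-⊆ (sets (E M ∷ F ∷ D ∷ [])
        (λ E F D → (F , E) ∷ [] ⊢ F ─′ D ⊆′ E ∩′ F ─′ D) (F⊆E ∷ [])) nonempty′
    ; splits    = begin
        rk M (D ∩ F) + rk M ((E M ∩ F ─ D) ∩ F)
          ≤⟨ +-mono-≤
              (rk-monotone M _ _ (p∩q⊆p D F))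
              (rk-monotone M _ _ (sets (E M ∷ F ∷ D ∷ [])
                (λ E F D → [] ⊢ (E ∩′ F ─′ D) ∩′ F ⊆′ F ─′ D) [])) ⟩
        rk M D + rk M (F ─ D)                   ≤⟨ splits ⟩
        rk M F                                  ≤⟨ rk-monotone M _ _ (sets (E M ∷ F ∷ [])
                                                     (λ E F → (F , E) ∷ [] ⊢ F ⊆′ (E ∩′ F) ∩′ F) (F⊆E ∷ [])) ⟩
        rk M ((E M ∩ F) ∩ F)                    ∎
    }
    where
    open Separator sep
    open ≤-Reasoning

  separator⇒¬connected-restriction : ∀ {D} → Separator M F D → ¬ Connected (M ∣ᴹ F)
  separator⇒¬connected-restriction = separator⇒¬connected (M ∣ᴹ F) ∘ separator-restriction

  noSeparator⇒connected-restriction : (∀ {D} → ¬ Separator M F D) → Connected (M ∣ᴹ F)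
  noSeparator⇒connected-restriction none =
    noSeparator⇒connected (M ∣ᴹ F) (none ∘ restriction-separator)

-- A separation of `M /ᴹ F` into `D` and `E M ─ (F ∪ D)`, with the rank differences cleared so that
-- no truncated subtraction remains.
record ContractionSeparator (M : Matroid u) (F D : Subset u) : Set where
  field
    ⊆E─F      : D ⊆ E M ─ F
    nonempty  : Nonempty D
    nonempty′ : Nonempty (E M ─ (F ∪ D))
    splits    : rk M (F ∪ D) + rk M (E M ─ D) ≤ rank M + rk M F

module _ (M : Matroid u) {F : Subset u} (F⊆E : F ⊆ E M) where

  private
    module _ (D : Subset u) where
      ρ : Vec ℕ 7
      ρ = rk M (D ∪ F) ∷ rk M ((E M ─ F ─ D) ∪ F) ∷ rk M ((E M ─ F) ∪ F) ∷ rk M F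
        ∷ (rk M (D ∪ F) ∸ rk M F) ∷ (rk M ((E M ─ F ─ D) ∪ F) ∸ rk M F) ∷ (rk M ((E M ─ F) ∪ F) ∸ rk M F) ∷ []

      F≤ : ∀ X → rk M F ≤ rk M (X ∪ F)
      F≤ X = rk-monotone M _ _ (q⊆p∪q X F)

  contraction-separator : ∀ {D} → Separator (M /ᴹ F) (E M ─ F) D → ContractionSeparator M F D
  contraction-separator {D} sep = record
    { ⊆E─F      = ⊆X
    ; nonempty  = nonempty
    ; nonempty′ = nonempty-⊆
        (sets (E M ∷ F ∷ D ∷ []) (λ E F D → [] ⊢ E ─′ F ─′ D ⊆′ E ─′ (F ∪′ D)) []) nonempty′
    ; splits    = begin
        rk M (F ∪ D) + rk M (E M ─ D)
          ≤⟨ +-mono-≤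
              (rk-monotone M _ _ (sets (F ∷ D ∷ []) (λ F D → [] ⊢ F ∪′ D ⊆′ D ∪′ F) []))
              (rk-monotone M _ _ (sets (E M ∷ F ∷ D ∷ []) (λ E F D → [] ⊢ E ─′ D ⊆′ (E ─′ F ─′ D) ∪′ F) [])) ⟩
        rk M (D ∪ F) + rk M ((E M ─ F ─ D) ∪ F)
          ≤⟨ linear (ρ D)
              (λ a b c r a′ b′ c′ → (a′ :+ b′ :≤ c′) ∷ (a :≤ r :+ a′) ∷ (b :≤ r :+ b′) ∷ (c′ :+ r :≤ c) ∷ []
                ⊢ a :+ b :≤ c :+ r)
              (splits ∷ m≤n+m∸n _ (rk M F) ∷ m≤n+m∸n _ (rk M F)
                ∷ ≤-reflexive (m∸n+n≡m (F≤ D (E M ─ F))) ∷ []) ⟩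
        rk M ((E M ─ F) ∪ F) + rk M F
          ≤⟨ +-monoˡ-≤ (rk M F) (rk≤rank M _) ⟩
        rank M + rk M F ∎
    }
    where
    open Separator sep
    open ≤-Reasoning

  separator-contraction : ∀ {D} → ContractionSeparator M F D → Separator (M /ᴹ F) (E M ─ F) D
  separator-contraction {D} sep = record
    { ⊆X        = ⊆E─F
    ; nonempty  = nonempty
    ; nonempty′ = nonempty-⊆
        (sets (E M ∷ F ∷ D ∷ []) (λ E F D → [] ⊢ E ─′ (F ∪′ D) ⊆′ E ─′ F ─′ D) []) nonempty′
    ; splits    = linear (ρ D)
        (λ a b c r a′ b′ c′ → (a :+ b :≤ c :+ r) ∷ (a′ :+ r :≤ a) ∷ (b′ :+ r :≤ b) ∷ (c :≤ r :+ c′) ∷ []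
          ⊢ a′ :+ b′ :≤ c′)
        ( ≤-trans (+-mono-≤
            (rk-monotone M _ _ (sets (F ∷ D ∷ []) (λ F D → [] ⊢ D ∪′ F ⊆′ F ∪′ D) []))
            (rk-monotone M _ _ (sets (E M ∷ F ∷ D ∷ [])
              (λ E F D → (F , E) ∷ (D , E ─′ F) ∷ [] ⊢ (E ─′ F ─′ D) ∪′ F ⊆′ E ─′ D) (F⊆E ∷ ⊆E─F ∷ []))))
          (≤-trans splits (+-monoˡ-≤ (rk M F)
            (rk-monotone M _ _ (sets (E M ∷ F ∷ []) (λ E F → [] ⊢ E ⊆′ (E ─′ F) ∪′ F) []))))
        ∷ ≤-reflexive (m∸n+n≡m (F≤ D D)) ∷ ≤-reflexive (m∸n+n≡m (F≤ D (E M ─ F ─ D)))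
        ∷ m≤n+m∸n _ (rk M F) ∷ [])
    }
    where
    open ContractionSeparator sep

  contractionSeparator⇒¬connected : ∀ {D} → ContractionSeparator M F D → ¬ Connected (M /ᴹ F)
  contractionSeparator⇒¬connected = separator⇒¬connected (M /ᴹ F) ∘ separator-contraction

  contraction-connected? : Connected (M /ᴹ F) ⊎ ∃ (ContractionSeparator M F)
  contraction-connected? with connected? (M /ᴹ F)
  ... | inj₁ connected = inj₁ connected
  ... | inj₂ (D , sep) = inj₂ (D , contraction-separator sep)

  contractionSeparator-comm : ∀ {D} → ContractionSeparator M F D → ContractionSeparator M F (E M ─ (F ∪ D))
  contractionSeparator-comm {D} sep = record
    { ⊆E─F      = sets (E M ∷ F ∷ D ∷ []) (λ E F D → [] ⊢ E ─′ (F ∪′ D) ⊆′ E ─′ F) []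
    ; nonempty  = nonempty′
    ; nonempty′ = nonempty-⊆ (sets (E M ∷ F ∷ D ∷ [])
        (λ E F D → (D , E ─′ F) ∷ [] ⊢ D ⊆′ E ─′ (F ∪′ (E ─′ (F ∪′ D)))) (⊆E─F ∷ [])) nonempty
    ; splits    = linear (rk M (F ∪ (E M ─ (F ∪ D))) ∷ rk M (E M ─ (E M ─ (F ∪ D)))
                         ∷ rk M (F ∪ D) ∷ rk M (E M ─ D) ∷ (rank M + rk M F) ∷ [])
        (λ a b c d k → (c :+ d :≤ k) ∷ (a :≤ d) ∷ (b :≤ c) ∷ [] ⊢ a :+ b :≤ k)
        ( splits
        ∷ rk-monotone M _ _ (sets (E M ∷ F ∷ D ∷ [])
            (λ E F D → (F , E) ∷ (D , E ─′ F) ∷ [] ⊢ F ∪′ (E ─′ (F ∪′ D)) ⊆′ E ─′ D) (F⊆E ∷ ⊆E─F ∷ []))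
        ∷ rk-monotone M _ _ (sets (E M ∷ F ∷ D ∷ [])
            (λ E F D → [] ⊢ E ─′ (E ─′ (F ∪′ D)) ⊆′ F ∪′ D) []) ∷ [])
    }
    where open ContractionSeparator sep

  -- A separator of M|(F ∪ D) has the connected set F on one side; the other side H
  -- lies in D and separates M.
  ∪-connected : Connected M → Connected (M ∣ᴹ F) → ∀ {D} → ContractionSeparator M F D →
                Connected (M ∣ᴹ (F ∪ D))
  ∪-connected connected connectedF {D} sep = noSeparator⇒connected-restriction M F∪D⊆E noSeparator
    where
    open ContractionSeparator sep
    F∪D⊆E : F ∪ D ⊆ E M
    F∪D⊆E = sets (E M ∷ F ∷ D ∷ []) (λ E F D → (F , E) ∷ (D , E ─′ F) ∷ [] ⊢ F ∪′ D ⊆′ E) (F⊆E ∷ ⊆E─F ∷ [])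

    noSide : ∀ {H} → Separator M (F ∪ D) H → ¬ (F ∩ H ⊆ ⊥)
    noSide {H} sepH F∩H⊆⊥ = separator⇒¬connected M (record
      { ⊆X        = F∪D⊆E ∘ H.⊆X
      ; nonempty  = H.nonempty
      ; nonempty′ = nonempty-⊆ (sets (E M ∷ F ∪ D ∷ H ∷ [])
          (λ E X H → (H , X) ∷ [] ⊢ E ─′ X ⊆′ E ─′ H) (H.⊆X ∷ [])) nonempty′
      -- The sets `F ∪ D ─ H` and `E M ─ D` cover `E M ─ H` and both contain `F`; submodularity for
      -- them cancels against the two given separations.
      ; splits    = linear (rk M H ∷ rk M (E M ─ H) ∷ rank M ∷ rk M (F ∪ D) ∷ rk M (E M ─ D)
                           ∷ rk M F ∷ rk M (F ∪ D ─ H) ∷ [])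
          (λ h h′ k x d′ f y → (x :+ d′ :≤ k :+ f) ∷ (h :+ y :≤ x) ∷ (h′ :+ f :≤ y :+ d′) ∷ []
            ⊢ h :+ h′ :≤ k)
          ( splits ∷ H.splits
          ∷ rk-submodular-⊆ M
              (sets (E M ∷ F ∷ D ∷ H ∷ []) (λ E F D H → [] ⊢ E ─′ H ⊆′ (F ∪′ D ─′ H) ∪′ (E ─′ D)) [])
              (sets (E M ∷ F ∷ D ∷ H ∷ [])
                (λ E F D H → (F , E) ∷ (D , E ─′ F) ∷ (F ∩′ H , ⊥′) ∷ [] ⊢ F ⊆′ (F ∪′ D ─′ H) ∩′ (E ─′ D))
                (F⊆E ∷ ⊆E─F ∷ F∩H⊆⊥ ∷ []))
          ∷ [])
      }) connected
      where module H = Separator sepH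

    noSeparator : ∀ {C} → ¬ Separator M (F ∪ D) C
    noSeparator {C} sepC with nonempty? (F ∩ C) | nonempty? (F ─ C)
    ... | no empty | _ = noSide sepC (empty⇒⊆⊥ empty)
    -- `F` meets both sides, so `C` cuts `F` itself, against the connectedness of `M ∣ᴹ F`.
    ... | yes p    | yes q = separator⇒¬connected-restriction M F⊆E (record
      { ⊆X        = p∩q⊆p F C
      ; nonempty  = p
      ; nonempty′ = nonempty-⊆ (sets (F ∷ C ∷ []) (λ F C → [] ⊢ F ─′ C ⊆′ F ─′ (F ∩′ C)) []) q
      ; splits    = ≤-trans
          (+-monoʳ-≤ (rk M (F ∩ C)) (rk-monotone M _ _
            (sets (F ∷ C ∷ []) (λ F C → [] ⊢ F ─′ (F ∩′ C) ⊆′ F ─′ C) [])))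
          (split-⊆ M (Separator.splits sepC) (p⊆p∪q D))
      }) connectedF
    ... | yes _    | no empty = noSide (separator-comm M sepC)
      (sets (F ∷ D ∷ C ∷ []) (λ F D C → (F ─′ C , ⊥′) ∷ [] ⊢ F ∩′ (F ∪′ D ─′ C) ⊆′ ⊥′) (empty⇒⊆⊥ empty ∷ []))

-- Overfull sets and split flacets

module _ (M : Matroid u) (S : Subset u) where

  -- For a subset `S` of `E M` with `rank M` elements, this says that `S` is in the cover of `F`.
  Overfull : Subset u → Set
  Overfull F = rk M F < ∣ S ∩ F ∣

  private
    overfull-⊎ : ∀ {X Y} → rk M X + rk M Y < ∣ S ∩ X ∣ + ∣ S ∩ Y ∣ → Overfull X ⊎ Overfull Y
    overfull-⊎ {X} {Y} < with rk M X <? ∣ S ∩ X ∣ | rk M Y <? ∣ S ∩ Y ∣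
    ... | yes X< | _      = inj₁ X<
    ... | no  _  | yes Y< = inj₂ Y<
    ... | no  X≮ | no  Y≮ = contradiction (+-mono-≤ (≮⇒≥ X≮) (≮⇒≥ Y≮)) (<⇒≱ <)

    -- Across a separator of `X` both the ranks and the traces of `S` add up, so one of the two
    -- sides is again overfull, and each is smaller than `X`.
    descend : ∀ n {X} → ∣ X ∣ ≤ n → X ⊆ E M → Overfull X →
              ∃[ F ] F ⊆ E M × Connected (M ∣ᴹ F) × Overfull F
    descend n {X} ≤n X⊆E over with separator? M X
    ... | no  none = X , X⊆E , noSeparator⇒connected-restriction M X⊆E (λ sep → none (_ , sep)) , over
    descend zero {X} ≤n X⊆E over | yes (D , sep) =
      contradiction (≤-trans (nonempty⇒0< (nonempty-⊆ (Separator.⊆X sep) (Separator.nonempty sep))) ≤n) 1+n≰n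
    descend (suc n) {X} ≤n X⊆E over | yes (D , sep) =
      [ descend n (smaller nonempty′) (X⊆E ∘ ⊆X)
      , descend n (≤-pred (linear (∣ X ─ D ∣ ∷ ∣ D ∣ ∷ ∣ X ∣ ∷ n ∷ [])
          (λ y d x n → (y :+ d :≤ x) ∷ (con 1 :≤ d) ∷ (x :≤ con 1 :+ n) ∷ [] ⊢ con 1 :+ y :≤ con 1 :+ n)
          (part ∷ nonempty⇒0< nonempty ∷ ≤n ∷ []))) (X⊆E ∘ p─q⊆p X D)
      ]′ (overfull-⊎ {D} {X ─ D} (≤-<-trans splits (≤-trans over
           (sets (X ∷ D ∷ S ∷ []) (λ X D S → (D , X) ∷ [] ⊢ ∣ S ∩′ X ∣′ ≤′ ∣ S ∩′ D ∣′ +′ ∣ S ∩′ (X ─′ D) ∣′)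
             (⊆X ∷ [])))))
      where
      open Separator sep
      part : ∣ X ─ D ∣ + ∣ D ∣ ≤ ∣ X ∣
      part = sets (X ∷ D ∷ []) (λ X D → (D , X) ∷ [] ⊢ ∣ X ─′ D ∣′ +′ ∣ D ∣′ ≤′ ∣ X ∣′) (⊆X ∷ [])
      smaller : Nonempty (X ─ D) → ∣ D ∣ ≤ n
      smaller ne = linear (∣ X ─ D ∣ ∷ ∣ D ∣ ∷ ∣ X ∣ ∷ n ∷ [])
        (λ y d x n → (y :+ d :≤ x) ∷ (con 1 :≤ y) ∷ (x :≤ con 1 :+ n) ∷ [] ⊢ d :≤ n)
        (part ∷ nonempty⇒0< ne ∷ ≤n ∷ [])

    -- The two sides of a contraction separator, each joined with `F`, have total rank at most
    -- `rank M + rk M F`, while their traces on `S` have at least `∣ S ∣ + ∣ S ∩ F ∣` elements in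
    -- total. So one of them is overfull, and it is connected by `∪-connected`.
    ascend : Connected M → S ⊆ E M → rank M ≤ ∣ S ∣ → ∀ n {F} → ∣ E M ─ F ∣ ≤ n →
             F ⊆ E M → Connected (M ∣ᴹ F) → Overfull F →
             ∃[ F ] F ⊆ E M × Connected (M ∣ᴹ F) × Connected (M /ᴹ F) × Overfull F
    ascend connected S⊆E rank≤ n {F} ≤n F⊆E connectedF over with contraction-connected? M F⊆E
    ... | inj₁ connected/ = F , F⊆E , connectedF , connected/ , over
    ascend connected S⊆E rank≤ zero {F} ≤n F⊆E connectedF over | inj₂ (D , sep) =
      contradiction (≤-trans (nonempty⇒0< (nonempty-⊆ (ContractionSeparator.⊆E─F sep)
        (ContractionSeparator.nonempty sep))) ≤n) 1+n≰n
    ascend connected S⊆E rank≤ (suc n) {F} ≤n F⊆E connectedF over | inj₂ (D , sep) =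
      [ step sep , step (contractionSeparator-comm M F⊆E sep) ]′
        (overfull-⊎ {F ∪ D} {F ∪ (E M ─ (F ∪ D))} (begin-strict
          rk M (F ∪ D) + rk M (F ∪ (E M ─ (F ∪ D)))
            ≤⟨ +-monoʳ-≤ _ (rk-monotone M _ _ (sets (E M ∷ F ∷ D ∷ [])
                 (λ E F D → (F , E) ∷ (D , E ─′ F) ∷ [] ⊢ F ∪′ (E ─′ (F ∪′ D)) ⊆′ E ─′ D)
                 (F⊆E ∷ ⊆E─F ∷ []))) ⟩
          rk M (F ∪ D) + rk M (E M ─ D)     ≤⟨ splits ⟩
          rank M + rk M F                   <⟨ +-mono-≤-< rank≤ over ⟩
          ∣ S ∣ + ∣ S ∩ F ∣
            ≤⟨ sets (E M ∷ F ∷ D ∷ S ∷ [])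
                 (λ E F D S → (S , E) ∷ [] ⊢ ∣ S ∣′ +′ ∣ S ∩′ F ∣′
                   ≤′ ∣ S ∩′ (F ∪′ D) ∣′ +′ ∣ S ∩′ (F ∪′ (E ─′ (F ∪′ D))) ∣′) (S⊆E ∷ []) ⟩
          ∣ S ∩ (F ∪ D) ∣ + ∣ S ∩ (F ∪ (E M ─ (F ∪ D))) ∣ ∎))
      where
      open ContractionSeparator sep
      open ≤-Reasoning
      step : ∀ {D} → ContractionSeparator M F D → Overfull (F ∪ D) →
             ∃[ F ] F ⊆ E M × Connected (M ∣ᴹ F) × Connected (M /ᴹ F) × Overfull F
      step {D} sep over = ascend connected S⊆E rank≤ n
        (linear (∣ E M ─ (F ∪ D) ∣ ∷ ∣ D ∣ ∷ ∣ E M ─ F ∣ ∷ n ∷ [])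
          (λ y d x n → (y :+ d :≤ x) ∷ (con 1 :≤ d) ∷ (x :≤ con 1 :+ n) ∷ [] ⊢ y :≤ n)
          ( sets (E M ∷ F ∷ D ∷ [])
              (λ E F D → (D , E ─′ F) ∷ [] ⊢ ∣ E ─′ (F ∪′ D) ∣′ +′ ∣ D ∣′ ≤′ ∣ E ─′ F ∣′) (D.⊆E─F ∷ [])
          ∷ nonempty⇒0< D.nonempty ∷ ≤n ∷ []))
        (sets (E M ∷ F ∷ D ∷ []) (λ E F D → (F , E) ∷ (D , E ─′ F) ∷ [] ⊢ F ∪′ D ⊆′ E) (F⊆E ∷ D.⊆E─F ∷ []))
        (∪-connected M F⊆E connected connectedF sep) over
        where module D = ContractionSeparator sep

  abstract
    -- `S` itself is overfull; `descend` and then `ascend` lead from it to `F`. The remaining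
    -- conditions hold because their failure would produce a separator of `M` or of `M /ᴹ F`, or
    -- would make `F` span `M`.
    overfull-splitFlacet : Connected M → S ⊆ E M → ∣ S ∣ ≡ rank M → rk M S < rank M →
                           ∃[ F ] SplitFlacet M F × Overfull F
    overfull-splitFlacet connected S⊆E ∣S∣≡rank S<rank
      with descend _ ≤-refl S⊆E 
             (≤-trans (respʳ _≤_ (sym ∣S∣≡rank) S<rank)
               (sets (S ∷ []) (λ S → [] ⊢ ∣ S ∣′ ≤′ ∣ S ∩′ S ∣′) []))
    ... | F₀ , F₀⊆E , connectedF₀ , over₀
      with ascend connected S⊆E (≤-reflexive (sym ∣S∣≡rank)) _ ≤-refl F₀⊆E connectedF₀ over₀
    ... | F , F⊆E , connectedF , connected/F , over =
      F
      , ( (flat , connectedF , connected/F) , 0<rk , ≤-trans over (∣p∩q∣≤∣q∣ S F)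
        , proj₁ E─F , proj₂ E─F , ¬coloop (proj₂ E─F))
      , over
      where
      rk<rank : rk M F < rank M
      rk<rank = respʳ _≤_ ∣S∣≡rank (≤-trans over (∣p∩q∣≤∣p∣ S F))

      F-nonempty : Nonempty F
      F-nonempty = 0<⇒nonempty (≤-trans (≤-trans (s≤s z≤n) over) (∣p∩q∣≤∣q∣ S F))

      extends : ∀ {x} → rk M (F ∪ ⁅ x ⁆) ≤ rk M F → Nonempty (E M ─ (F ∪ ⁅ x ⁆))
      extends {x} ≤rk with nonempty? (E M ─ (F ∪ ⁅ x ⁆))
      ... | yes nonempty = nonempty
      ... | no  empty = contradiction
        (≤-trans (rk-monotone M _ _ (sets (E M ∷ F ∪ ⁅ x ⁆ ∷ [])
          (λ E X → (E ─′ X , ⊥′) ∷ [] ⊢ E ⊆′ X) (empty⇒⊆⊥ empty ∷ []))) ≤rk)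
        (<⇒≱ rk<rank)

      flat : Flat M F
      -- An `x` that does not raise the rank is a loop of `M /ᴹ F`. It splits off because `extends`
      -- provides a further element outside `F`.
      flat = F⊆E , λ x x∈E x∉F → ≰⇒> λ ≤rk → contractionSeparator⇒¬connected M F⊆E {⁅ x ⁆} (record
        { ⊆E─F      = ⁅x⁆⊆ (x∈p∧x∉q⇒x∈p─q x∈E x∉F)
        ; nonempty  = x , x∈⁅x⁆ x
        ; nonempty′ = extends ≤rk
        ; splits    = respˡ _≤_ (+-comm (rk M (E M - x)) _) (+-mono-≤ (rk≤rank M _) ≤rk)
        }) connected/F

      E─F : Nonempty (E M ─ F)
      E─F with nonempty? (E M ─ F)
      ... | yes nonempty = nonempty
      ... | no  empty = contradiction
        (rk-monotone M _ _ (sets (E M ∷ F ∷ []) (λ E X → (E ─′ X , ⊥′) ∷ [] ⊢ E ⊆′ X) (empty⇒⊆⊥ empty ∷ [])))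
        (<⇒≱ rk<rank)

      0<rk : 0 < rk M F
      0<rk = ≰⇒> λ rk≤0 → separator⇒¬connected M {F} (record
        { ⊆X        = F⊆E
        ; nonempty  = F-nonempty
        ; nonempty′ = E─F
        ; splits    = +-mono-≤ rk≤0 (rk≤rank M (E M ─ F))
        }) connected

      ¬coloop : ∀ {x} → x ∈ E M ─ F → ¬ Coloop M x
      -- If `E M - x` had full rank, `J` would be a basis avoiding `x`. Hence a coloop `x` separates
      -- `M`.
      ¬coloop {x} x∈E─F (x∈E , ∈bases) with independent-subset M (E M - x)
      ... | J , J⊆ , ind , spans = separator⇒¬connected M {⁅ x ⁆} (record
        { ⊆X        = ⁅x⁆⊆ x∈E
        ; nonempty  = x , x∈⁅x⁆ x
        ; nonempty′ = nonempty-⊆ (sets (E M ∷ F ∷ ⁅ x ⁆ ∷ [])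
            (λ E F x → (F , E) ∷ (x , E ─′ F) ∷ [] ⊢ F ⊆′ E ─′ x) (F⊆E ∷ ⁅x⁆⊆ x∈E─F ∷ [])) F-nonempty
        ; splits    = ≤-trans
            (+-monoˡ-≤ (rk M (E M - x)) (≤-trans (rk≤∣∣ M ⁅ x ⁆) (≤-reflexive (∣⁅x⁆∣≡1 x))))
            (≰⇒> λ rank≤ → x∈p─q⇒x∉q (E M) ⁅ x ⁆
              (J⊆ (∈bases J (independent⇒basis M ind (≤-trans rank≤ spans)))) (x∈⁅x⁆ x))
        }) connected

-- Elementary split matroids are covered

Covered : Matroid u → Set
Covered M = ∀ {S} → S ⊆ E M → ∣ S ∣ ≡ rank M → rank M ≤ rk M S ⊎ ∃[ F ] Stressed M F × Cover M F S

module _ {M M₁ M₂ : Matroid u} (sum : IsDirectSum M M₁ M₂) where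

  open IsDirectSum sum

  rk-summand≤rank : rk M (E M₁) ≤ rank M₁
  rk-summand≤rank = ≤-trans (rk-summand M sum (directSum-∩⊆⊥ M sum)) (rk≤rank M₁ _)

  -- Restricting to `E M₁` gives `M₁` and contracting it gives `M₂`: uniformity of the former yields
  -- `lower`, that of the latter `upper`.
  summand-stressed : Uniform M₁ → Uniform M₂ → Stressed M (E M₁)
  summand-stressed uniform₁ uniform₂ = bounds⇒stressed M (E M₁) (record
    { ⊆E    = directSum-⊆E M sum
    ; lower = λ {X} X⊆E₁ → begin
        rk M (E M₁) ⊓ ∣ X ∣                       ≤⟨ ⊓-mono-≤ rk-summand≤rank (⊆⇒∣∣≤∣∩∣ X⊆E₁) ⟩
        rank M₁ ⊓ ∣ X ∩ E M₁ ∣                    ≤⟨ uniform⇒uniformRank M₁ uniform₁ (p∩q⊆q X (E M₁)) ⟩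
        rk M₁ (X ∩ E M₁)                          ≤⟨ m≤m+n _ _ ⟩
        rk M₁ (X ∩ E M₁) + rk M₂ (X ∩ E M₂)       ≡⟨ rk-sum X ⟨
        rk M X                                    ∎
    ; upper = λ {X} E₁⊆X X⊆E → begin
        rank M ⊓ (rk M (E M₁) + ∣ X ─ E M₁ ∣)
          ≤⟨ ⊓-mono-≤ rank≤ (+-mono-≤ rk-summand≤rank (sets (X ∷ E M ∷ E M₁ ∷ E M₂ ∷ [])
               (λ X E A B → (X , E) ∷ (E , A ∪′ B) ∷ [] ⊢ ∣ X ─′ A ∣′ ≤′ ∣ X ∩′ B ∣′)
               (X⊆E ∷ subst (E M ⊆_) ground id ∷ []))) ⟩
        (rank M₁ + rank M₂) ⊓ (rank M₁ + ∣ X ∩ E M₂ ∣)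
          ≡⟨ +-distribˡ-⊓ (rank M₁) (rank M₂) _ ⟨
        rank M₁ + rank M₂ ⊓ ∣ X ∩ E M₂ ∣
          ≤⟨ +-mono-≤ (rk-monotone M₁ _ _ (sets (X ∷ E M₁ ∷ []) (λ X A → (A , X) ∷ [] ⊢ A ⊆′ X ∩′ A) (E₁⊆X ∷ [])))
                      (uniform⇒uniformRank M₂ uniform₂ (p∩q⊆q X (E M₂))) ⟩
        rk M₁ (X ∩ E M₁) + rk M₂ (X ∩ E M₂)
          ≡⟨ rk-sum X ⟨
        rk M X ∎
    })
    where
    open ≤-Reasoning
    rank≤ : rank M ≤ rank M₁ + rank M₂
    rank≤ = ≤-trans (≤-reflexive (rk-sum (E M))) (+-mono-≤ (rk≤rank M₁ _) (rk≤rank M₂ _))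

overfull⇒cover : ∀ (M : Matroid u) {S F} → S ⊆ E M → ∣ S ∣ ≡ rank M → Overfull M S F → Cover M F S
overfull⇒cover M {F = F} S⊆E ∣S∣≡rank over = S⊆E , ∣S∣≡rank , respˡ _≤_ (+-comm 1 (rk M F)) over

-- For connected `M` the overfull split flacet is stressed. In a direct sum, `S` either exceeds the
-- rank on one of the stressed summands or meets both in independent sets, and then it is a basis.
elementarySplit⇒covered : (M : Matroid u) → ElementarySplit M → Covered M
elementarySplit⇒covered M (inj₁ (connected , split)) {S} S⊆E ∣S∣≡rank with rank M ≤? rk M S
... | yes rank≤ = inj₁ rank≤
... | no  rank≰ with overfull-splitFlacet M S connected S⊆E ∣S∣≡rank (≰⇒> rank≰)
...   | F , flacet , over = inj₂ (F , split F flacet , overfull⇒cover M S⊆E ∣S∣≡rank over)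
elementarySplit⇒covered M (inj₂ (M₁ , M₂ , sum , uniform₁ , uniform₂)) {S} S⊆E ∣S∣≡rank
  with rk M (E M₁) <? ∣ S ∩ E M₁ ∣ | rk M (E M₂) <? ∣ S ∩ E M₂ ∣
... | yes over₁ | _ =
  inj₂ (_ , summand-stressed sum uniform₁ uniform₂ , overfull⇒cover M S⊆E ∣S∣≡rank over₁)
... | no _ | yes over₂ =
  inj₂ (_ , summand-stressed (directSum-comm M sum) uniform₂ uniform₁ , overfull⇒cover M S⊆E ∣S∣≡rank over₂)
... | no ≯₁ | no ≯₂ = inj₁ (begin
  rank M                                ≡⟨ ∣S∣≡rank ⟨
  ∣ S ∣                                 ≤⟨ sets (S ∷ E M ∷ E M₁ ∷ E M₂ ∷ [])
                                             (λ S E A B → (S , E) ∷ (E , A ∪′ B) ∷ []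
                                               ⊢ ∣ S ∣′ ≤′ ∣ S ∩′ A ∣′ +′ ∣ S ∩′ B ∣′)
                                             (S⊆E ∷ subst (E M ⊆_) ground id ∷ []) ⟩
  ∣ S ∩ E M₁ ∣ + ∣ S ∩ E M₂ ∣           ≤⟨ +-mono-≤ (part sum uniform₁ (≮⇒≥ ≯₁))
                                             (part (directSum-comm M sum) uniform₂ (≮⇒≥ ≯₂)) ⟩
  rk M₁ (S ∩ E M₁) + rk M₂ (S ∩ E M₂)   ≡⟨ rk-sum S ⟨
  rk M S                                ∎)
  where
  open IsDirectSum sum
  open ≤-Reasoning
  part : ∀ {M₁ M₂} → IsDirectSum M M₁ M₂ → Uniform M₁ → ∣ S ∩ E M₁ ∣ ≤ rk M (E M₁) →
         ∣ S ∩ E M₁ ∣ ≤ rk M₁ (S ∩ E M₁)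
  part {M₁} sum uniform ≤rk = ≤-trans
    (⊓-glb (≤-trans ≤rk (rk-summand≤rank sum)) ≤-refl)
    (uniform⇒uniformRank M₁ uniform (p∩q⊆q S (E M₁)))

-- Bases of iterated relaxations

module _ {M N : Matroid u} {A : Subset u} (rel : IsRel M A N) where

  open IsRel rel

  isRel-basis : ∀ {B} → IsBasis M B → IsBasis N B
  isRel-basis {B} = Equivalence.from (bases B) ∘ inj₁

  isRel-rank : rank N ≡ rank M
  isRel-rank with basis-⊇ M {⊥} (≤-trans (≤-reflexive (∣⊥∣≡0 u)) z≤n)
  ... | B , _ , basis@(_ , rk≡∣B∣ , rk≡rank) =
    let _ , rkN≡∣B∣ , rkN≡rank = isRel-basis basis
    in trans (sym rkN≡rank) (trans rkN≡∣B∣ (trans (sym rk≡∣B∣) rk≡rank))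

  -- `IsRel` only speaks of bases, so the ranks are compared through a basis of `M` extending a
  -- maximal independent subset of `X`; it is a basis of `N` too.
  rk≤isRel-rk : ∀ X → rk M X ≤ rk N X
  rk≤isRel-rk X with independent-subset M X
  ... | J , J⊆X , ind , spans with basis-⊇ M ind
  ...   | B , J⊆B , basis = let _ , rkN≡∣B∣ , _ = isRel-basis basis in begin
    rk M X ≤⟨ spans ⟩
    rk M J ≤⟨ rk≤∣∣ M J ⟩
    ∣ J ∣  ≤⟨ independent-⊆ N J⊆B (≤-reflexive (sym rkN≡∣B∣)) ⟩
    rk N J ≤⟨ rk-monotone N J X J⊆X ⟩
    rk N X ∎
    where open ≤-Reasoning

relaxes-E : ∀ {M N : Matroid u} {Fs} → Relaxes M Fs N → E N ≡ E M
relaxes-E []           = refl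
relaxes-E (rel ∷ rels) = trans (relaxes-E rels) (IsRel.ground rel)

-- Ranks only grow along the chain while the total rank stays fixed, so a cover taken in a later
-- matroid is contained in the cover of the same set in `M`.
relaxes-basis : ∀ {M N : Matroid u} {Fs S} → Relaxes M Fs N → IsBasis N S →
                IsBasis M S ⊎ ∃[ F ] F List.∈ Fs × Cover M F S
relaxes-basis []           basis = inj₁ basis
relaxes-basis {M = M} {S = S} (rel ∷ rels) basis with relaxes-basis rels basis
... | inj₁ basis′ = [ inj₁ , (λ cover → inj₂ (_ , here refl , cover)) ]′
  (Equivalence.to (IsRel.bases rel S) basis′)
... | inj₂ (F , F∈ , S⊆E , ∣S∣≡rank , ≤∣S∩F∣) = inj₂ (F , there F∈
  , subst (S ⊆_) (IsRel.ground rel) S⊆E , trans ∣S∣≡rank (isRel-rank rel)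
  , ≤-trans (+-monoˡ-≤ 1 (rk≤isRel-rk rel F)) ≤∣S∩F∣)

uniform-relaxation⇒covered : ∀ {M N : Matroid u} {Fs n} → ListsStressed M Fs →
                             Relaxes M Fs N → IsU (rank M) n N → Covered M
uniform-relaxation⇒covered {M = M} {N = N} lists rels (_ , bases) {S} S⊆E ∣S∣≡rank
  with relaxes-basis rels (Equivalence.from (bases S) (subst (S ⊆_) (sym (relaxes-E rels)) S⊆E , ∣S∣≡rank))
... | inj₁ (_ , _ , rk≡rank)  = inj₁ (≤-reflexive (sym rk≡rank))
... | inj₂ (F , F∈ , cover) =
  inj₂ (F , proj₁ (Equivalence.to (ListsStressed.complete lists F) F∈) , cover)

-- Covered matroids: stressed flacets and direct sums

module _ (M : Matroid u) where

  -- Exchanging an element of a basis T outside F for an element e of F gives a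
  -- k-set S that exceeds the rank by at most 1 on every set, and by 1 on F.  If
  -- S is in the cover of A, then by supermodularity it also exceeds the rank on
  -- A ∩ F, which therefore spans A.
  connected-flat-stressed : Covered M → ∀ {F} → Flat M F → Connected (M ∣ᴹ F) →
                            rk M F < ∣ F ∣ → rk M F < rank M → Stressed M F
  connected-flat-stressed covered {F} (F⊆E , closed) connected rk<∣F∣ rk<rank
    with independent-subset M F
  ... | I , I⊆F , indI , spansI with basis-⊇ M indI
  ...   | T , I⊆T , T⊆E , rk≡∣T∣ , rk≡rank = conclude (covered S⊆E ∣S∣≡rank)
    where
    ind : ∀ {X} → X ⊆ T → ∣ X ∣ ≤ rk M X
    ind X⊆T = independent-⊆ M X⊆T (≤-reflexive (sym rk≡∣T∣))

    ∣I∣≤ : ∣ I ∣ ≤ rk M F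
    ∣I∣≤ = ≤-trans indI (rk-monotone M I F I⊆F)

    F─I : Nonempty (F ─ I)
    F─I = 0<⇒nonempty (linear (∣ F ─ I ∣ ∷ ∣ F ∣ ∷ ∣ I ∣ ∷ rk M F ∷ [])
      (λ d f i r → (con 1 :+ r :≤ f) ∷ (i :≤ r) ∷ (f :≤ d :+ i) ∷ [] ⊢ con 1 :≤ d)
      (rk<∣F∣ ∷ ∣I∣≤ ∷ sets (F ∷ I ∷ []) (λ F I → [] ⊢ ∣ F ∣′ ≤′ ∣ F ─′ I ∣′ +′ ∣ I ∣′) [] ∷ []))

    T─F : Nonempty (T ─ F)
    T─F = 0<⇒nonempty (linear (∣ T ─ F ∣ ∷ ∣ T ∩ F ∣ ∷ ∣ T ∣ ∷ rk M F ∷ rank M ∷ [])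
      (λ d i t r k → (con 1 :+ r :≤ k) ∷ (k :≤ t) ∷ (t :≤ d :+ i) ∷ (i :≤ r) ∷ [] ⊢ con 1 :≤ d)
      ( rk<rank ∷ ≤-reflexive (trans (sym rk≡rank) rk≡∣T∣)
      ∷ sets (T ∷ F ∷ []) (λ T F → [] ⊢ ∣ T ∣′ ≤′ ∣ T ─′ F ∣′ +′ ∣ T ∩′ F ∣′) []
      ∷ ≤-trans (ind (p∩q⊆p T F)) (rk-monotone M _ _ (p∩q⊆q T F)) ∷ []))

    e b S : Subset u
    e = ⁅ proj₁ F─I ⁆
    b = ⁅ proj₁ T─F ⁆
    S = (T ∪ e) ─ b

    e⊆ : e ⊆ F ─ I
    e⊆ = ⁅x⁆⊆ (proj₂ F─I)

    b⊆ : b ⊆ T ─ F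
    b⊆ = ⁅x⁆⊆ (proj₂ T─F)

    ∣e∣≡1 : ∣ e ∣ ≡ 1
    ∣e∣≡1 = ∣⁅x⁆∣≡1 (proj₁ F─I)

    ∣b∣≡1 : ∣ b ∣ ≡ 1
    ∣b∣≡1 = ∣⁅x⁆∣≡1 (proj₁ T─F)

    -- `I` lies in the independent set `T ∩ F` and already has the rank of `F`.
    T∩F⊆I : T ∩ F ⊆ I
    T∩F⊆I = ∣─∣≤0⇒⊆ (linear (∣ T ∩ F ─ I ∣ ∷ ∣ I ∣ ∷ ∣ T ∩ F ∣ ∷ rk M F ∷ rk M I ∷ [])
      (λ d i x r rI → (d :+ i :≤ x) ∷ (x :≤ r) ∷ (r :≤ rI) ∷ (rI :≤ i) ∷ [] ⊢ d :≤ con 0)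
      ( sets (T ∷ F ∷ I ∷ []) (λ T F I → (I , T) ∷ (I , F) ∷ [] ⊢ ∣ T ∩′ F ─′ I ∣′ +′ ∣ I ∣′ ≤′ ∣ T ∩′ F ∣′)
          (I⊆T ∷ I⊆F ∷ [])
      ∷ ≤-trans (ind (p∩q⊆p T F)) (rk-monotone M _ _ (p∩q⊆q T F)) ∷ spansI ∷ rk≤∣∣ M I ∷ []))

    S⊆E : S ⊆ E M
    S⊆E = sets (T ∷ F ∷ E M ∷ e ∷ b ∷ I ∷ [])
      (λ T F E e b I → (T , E) ∷ (F , E) ∷ (e , F ─′ I) ∷ [] ⊢ (T ∪′ e) ─′ b ⊆′ E)
      (T⊆E ∷ F⊆E ∷ e⊆ ∷ [])

    ∣S∣≡rank : ∣ S ∣ ≡ rank M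
    ∣S∣≡rank = trans
      (+-cancelʳ-≡ 1 ∣ S ∣ ∣ T ∣ (subst₂ (λ x y → ∣ S ∣ + x ≡ ∣ T ∣ + y) ∣b∣≡1 ∣e∣≡1 (≤-antisym
        (sets ρ (λ T F e b I → (b , T ─′ F) ∷ []
            ⊢ ∣ (T ∪′ e) ─′ b ∣′ +′ ∣ b ∣′ ≤′ ∣ T ∣′ +′ ∣ e ∣′)
          (b⊆ ∷ []))
        (sets ρ (λ T F e b I → (T ∩′ F , I) ∷ (e , F ─′ I) ∷ []
            ⊢ ∣ T ∣′ +′ ∣ e ∣′ ≤′ ∣ (T ∪′ e) ─′ b ∣′ +′ ∣ b ∣′)
          (T∩F⊆I ∷ e⊆ ∷ [])))))
      (trans (sym rk≡∣T∣) rk≡rank)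
      where ρ = T ∷ F ∷ e ∷ b ∷ I ∷ []

    excess≤1 : ∀ X → ∣ S ∩ X ∣ ≤ rk M X + 1
    excess≤1 X = begin
      ∣ S ∩ X ∣         ≤⟨ sets (T ∷ e ∷ b ∷ X ∷ [])
                             (λ T e b X → [] ⊢ ∣ ((T ∪′ e) ─′ b) ∩′ X ∣′ ≤′ ∣ T ∩′ X ∣′ +′ ∣ e ∣′) [] ⟩
      ∣ T ∩ X ∣ + ∣ e ∣ ≤⟨ +-mono-≤ (≤-trans (ind (p∩q⊆p T X)) (rk-monotone M _ _ (p∩q⊆q T X)))
                             (≤-reflexive ∣e∣≡1) ⟩
      rk M X + 1 ∎
      where open ≤-Reasoning

    excess-F : rk M F + 1 ≤ ∣ S ∩ F ∣
    excess-F = begin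
      rk M F + 1    ≤⟨ +-mono-≤ (≤-trans spansI (rk≤∣∣ M I)) (≤-reflexive (sym ∣e∣≡1)) ⟩
      ∣ I ∣ + ∣ e ∣ ≤⟨ sets (T ∷ F ∷ e ∷ b ∷ I ∷ [])
                         (λ T F e b I → (I , T) ∷ (I , F) ∷ (e , F ─′ I) ∷ (b , T ─′ F) ∷ []
                           ⊢ ∣ I ∣′ +′ ∣ e ∣′ ≤′ ∣ ((T ∪′ e) ─′ b) ∩′ F ∣′)
                         (I⊆T ∷ I⊆F ∷ e⊆ ∷ b⊆ ∷ []) ⟩
      ∣ S ∩ F ∣ ∎
      where open ≤-Reasoning

    conclude : rank M ≤ rk M S ⊎ ∃[ A ] Stressed M A × Cover M A S → Stressed M F
    conclude (inj₁ rank≤) = contradiction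
      (≤-trans (independent-⊆ M (p∩q⊆p S F) (≤-trans (≤-reflexive ∣S∣≡rank) rank≤))
        (rk-monotone M _ _ (p∩q⊆q S F)))
      (<⇒≱ (respˡ _≤_ (+-comm _ 1) excess-F))
    conclude (inj₂ (A , stressed , cover@(_ , _ , excess-A))) =
      subst (Stressed M) (⊆-antisym A⊆F F⊆A) stressed
      where
      open Relaxable (cover⇒relaxable M stressed (S , cover))

      -- The excess of `S` is at least 1 on `A` and on `F` but at most 1 on `A ∪ F`, which leaves at
      -- least 1 for `A ∩ F`.
      excess-∩ : rk M (A ∩ F) < ∣ A ∩ F ∣
      excess-∩ = linear (rk M (A ∩ F) ∷ ∣ A ∩ F ∣ ∷ rk M (A ∪ F) ∷ ∣ S ∩ (A ∪ F) ∣ ∷ rk M A ∷ ∣ S ∩ A ∣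
                        ∷ rk M F ∷ ∣ S ∩ F ∣ ∷ [])
        (λ i ∣i∣ j ∣j∣ a ∣a∣ f ∣f∣ →
            (j :+ i :≤ a :+ f) ∷ (∣a∣ :+ ∣f∣ :≤ ∣j∣ :+ ∣i∣) ∷ (∣j∣ :≤ j :+ con 1)
          ∷ (a :+ con 1 :≤ ∣a∣) ∷ (f :+ con 1 :≤ ∣f∣) ∷ [] ⊢ con 1 :+ i :≤ ∣i∣)
        ( rk-submodular M A F
        ∷ sets (S ∷ A ∷ F ∷ []) (λ S A F → [] ⊢
            ∣ S ∩′ A ∣′ +′ ∣ S ∩′ F ∣′ ≤′ ∣ S ∩′ (A ∪′ F) ∣′ +′ ∣ A ∩′ F ∣′) []
        ∷ excess≤1 (A ∪ F) ∷ excess-A ∷ excess-F ∷ [])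

      rk-∪ : rk M (A ∪ F) ≤ rk M F
      rk-∪ = linear (rk M (A ∩ F) ∷ rk M (A ∪ F) ∷ rk M A ∷ rk M F ∷ [])
        (λ i j a f → (j :+ i :≤ a :+ f) ∷ (a :≤ i) ∷ [] ⊢ j :≤ f)
        (rk-submodular M A F ∷ ⊓≤⇒≤ (lower (p∩q⊆p A F)) excess-∩ ∷ [])

      A⊆F : A ⊆ F
      A⊆F {x} x∈A with x ∈? F
      ... | yes x∈F = x∈F
      ... | no  x∉F = contradiction
        (≤-trans (rk-monotone M _ _ (sets (A ∷ F ∷ ⁅ x ⁆ ∷ [])
          (λ A F x → (x , A) ∷ [] ⊢ F ∪′ x ⊆′ A ∪′ F) (⁅x⁆⊆ x∈A ∷ []))) rk-∪)
        (<⇒≱ (closed x (⊆E x∈A) x∉F))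

      F⊆A : F ⊆ A
      F⊆A with nonempty? (F ─ A)
      ... | no  empty    = sets (F ∷ A ∷ []) (λ F A → (F ─′ A , ⊥′) ∷ [] ⊢ F ⊆′ A) (empty⇒⊆⊥ empty ∷ [])
      -- Since `rk M F < rank M`, `upper` makes the elements of `F ─ A` coloops of `M ∣ᴹ F`, so `A`
      -- separates `F`.
      ... | yes nonempty = contradiction connected (separator⇒¬connected-restriction M F⊆E {A} (record
        { ⊆X        = A⊆F
        ; nonempty  = 0<⇒nonempty (≤-trans (s≤s z≤n) dependent)
        ; nonempty′ = nonempty
        ; splits    = ≤-trans (+-monoʳ-≤ (rk M A) (rk≤∣∣ M (F ─ A)))
            (⊓≤⇒≤ (respˡ _≤_ (⊓-comm (rank M) _) (upper A⊆F F⊆E)) rk<rank)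
        }))

  splitFlacet-stressed : Covered M → ∀ F → SplitFlacet M F → Stressed M F
  splitFlacet-stressed covered F ((flat@(_ , closed) , connectedF , _) , _ , rk<∣F∣ , x , x∈E─F , _) =
    connected-flat-stressed covered flat connectedF rk<∣F∣
      (≤-trans (closed x (p─q⊆p (E M) F x∈E─F) (x∈p─q⇒x∉q (E M) F x∈E─F)) (rk≤rank M _))

  -- Once `A` splits `M`, restricting to `E M ─ A` amounts to contracting `A`; thus `upper` for
  -- `A ∪ X` gives uniformity of the second summand.
  stressed-splits⇒elementarySplit : ∀ {A} → StressedBounds M A → rk M A + rk M (E M ─ A) ≤ rank M →
                                    ElementarySplit M
  stressed-splits⇒elementarySplit {A} st splits = inj₂
    ( M ∣ᴹ A , M ∣ᴹ (E M ─ A) , splits⇒directSum M splits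
    , proj₁ (proj₂ (bounds⇒stressed M A st)) , uniformRank⇒uniform (M ∣ᴹ (E M ─ A)) uniform′)
    where
    open StressedBounds st
    open ≤-Reasoning
    uniform′ : UniformRank (M ∣ᴹ (E M ─ A))
    uniform′ {X} X⊆ = +-cancelˡ-≤ (rk M A) _ _ (begin
      rk M A + rank (M ∣ᴹ (E M ─ A)) ⊓ ∣ X ∣
        ≤⟨ +-monoʳ-≤ (rk M A) (⊓-monoˡ-≤ ∣ X ∣ (rk-monotone M _ _ (p∩q⊆q (E M ∩ (E M ─ A)) (E M ─ A)))) ⟩
      rk M A + rk M (E M ─ A) ⊓ ∣ X ∣
        ≡⟨ +-distribˡ-⊓ (rk M A) (rk M (E M ─ A)) ∣ X ∣ ⟩
      (rk M A + rk M (E M ─ A)) ⊓ (rk M A + ∣ X ∣)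
        ≤⟨ ⊓-mono-≤ splits (+-monoʳ-≤ (rk M A) (sets (X ∷ E M ∷ A ∷ [])
             (λ X E A → (X , E ∩′ (E ─′ A)) ∷ [] ⊢ ∣ X ∣′ ≤′ ∣ A ∪′ X ─′ A ∣′) (X⊆ ∷ []))) ⟩
      rank M ⊓ (rk M A + ∣ A ∪ X ─ A ∣)
        ≤⟨ upper (p⊆p∪q X) (sets (X ∷ E M ∷ A ∷ [])
             (λ X E A → (X , E ∩′ (E ─′ A)) ∷ (A , E) ∷ [] ⊢ A ∪′ X ⊆′ E) (X⊆ ∷ ⊆E ∷ [])) ⟩
      rk M (A ∪ X)
        ≤⟨ rk-subadditive M (sets (X ∷ E M ∷ A ∷ [])
             (λ X E A → (X , E ∩′ (E ─′ A)) ∷ [] ⊢ A ∪′ X ⊆′ A ∪′ (X ∩′ (E ─′ A))) (X⊆ ∷ [])) ⟩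
      rk M A + rk M (X ∩ (E M ─ A)) ∎)

  -- The degenerate case `A = E M`: the second summand has an empty ground set.
  uniform⇒elementarySplit : Uniform M → ElementarySplit M
  uniform⇒elementarySplit uni = stressed-splits⇒elementarySplit {E M}
    (record
      { ⊆E    = id
      ; lower = uniform⇒uniformRank M uni
      ; upper = λ E⊆X _ → ≤-trans (m⊓n≤m _ _) (rk-monotone M _ _ E⊆X)
      })
    (begin
      rank M + rk M (E M ─ E M)   ≤⟨ +-monoʳ-≤ (rank M) (rk≤∣∣ M _) ⟩
      rank M + ∣ E M ─ E M ∣      ≤⟨ +-monoʳ-≤ (rank M) (sets (E M ∷ []) (λ E → [] ⊢ ∣ E ─′ E ∣′ ≤′ ∣ ⊥′ ∣′) []) ⟩
      rank M + ∣ ⊥ {u} ∣          ≡⟨ cong (rank M +_) (∣⊥∣≡0 u) ⟩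
      rank M + 0                  ≡⟨ +-identityʳ (rank M) ⟩
      rank M                      ∎)
    where open ≤-Reasoning

  module _ {A : Subset u} (relaxable : Relaxable M A) where

    open Relaxable relaxable

    -- Both M|A and M/A are uniform, and a uniform matroid is disconnected only if
    -- it consists of loops or of coloops.
    separator-⊇⇒splits : ∀ {D} → A ⊆ D → Separator M (E M) D → rk M A + rk M (E M ─ A) ≤ rank M
    separator-⊇⇒splits {D} A⊆D sep = conclude (⊓-sel (rank M) (a + s)) (⊓-sel (rank M) (a + t))
      where
      open Separator sep
      a s t : ℕ
      a = rk M A
      s = ∣ D ─ A ∣
      t = ∣ E M ─ D ∣

      bound-s : rank M ⊓ (a + s) ≤ rk M D
      bound-s = upper A⊆D ⊆X

      bound-t : rank M ⊓ (a + t) ≤ a + rk M (E M ─ D)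
      bound-t = begin
        rank M ⊓ (a + t)
          ≤⟨ ⊓-monoʳ-≤ (rank M) (+-monoʳ-≤ a (sets (A ∷ D ∷ E M ∷ [])
               (λ A D E → (A , D) ∷ [] ⊢ ∣ E ─′ D ∣′ ≤′ ∣ A ∪′ (E ─′ D) ─′ A ∣′) (A⊆D ∷ []))) ⟩
        rank M ⊓ (a + ∣ A ∪ (E M ─ D) ─ A ∣)
          ≤⟨ upper (p⊆p∪q (E M ─ D)) (sets (A ∷ D ∷ E M ∷ [])
               (λ A D E → (A , E) ∷ [] ⊢ A ∪′ (E ─′ D) ⊆′ E) (⊆E ∷ [])) ⟩
        rk M (A ∪ (E M ─ D))
          ≤⟨ rk-subadditive M id ⟩
        a + rk M (E M ─ D) ∎
        where open ≤-Reasoning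

      0<t : 1 ≤ t
      0<t = nonempty⇒0< nonempty′

      total : rank M ⊓ (a + s) + rank M ⊓ (a + t) ≤ rank M + a
      total = linear (rank M ⊓ (a + s) ∷ rank M ⊓ (a + t) ∷ rank M ∷ a ∷ rk M D ∷ rk M (E M ─ D) ∷ [])
        (λ x y k a d d′ → (x :≤ d) ∷ (y :≤ a :+ d′) ∷ (d :+ d′ :≤ k) ∷ [] ⊢ x :+ y :≤ k :+ a)
        (bound-s ∷ bound-t ∷ splits ∷ [])

      D⊆A⇒splits : D ⊆ A → a + rk M (E M ─ A) ≤ rank M
      D⊆A⇒splits D⊆A = ≤-trans (+-mono-≤ (rk-monotone M _ _ A⊆D) (rk-monotone M _ _
        (sets (A ∷ D ∷ E M ∷ []) (λ A D E → (D , A) ∷ [] ⊢ E ─′ A ⊆′ E ─′ D) (D⊆A ∷ [])))) splits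

      -- Two minima equal to `rank M` contradict `proper`. If only the first is, `E M ─ D` would be
      -- empty; if only the second is, `D` is `A`. Otherwise `E M ─ A` has at most `rank M` minus
      -- `a` elements.
      conclude : rank M ⊓ (a + s) ≡ rank M ⊎ rank M ⊓ (a + s) ≡ a + s →
                 rank M ⊓ (a + t) ≡ rank M ⊎ rank M ⊓ (a + t) ≡ a + t → a + rk M (E M ─ A) ≤ rank M
      conclude (inj₁ p) (inj₁ q) = contradiction proper (≤⇒≯
        (+-cancelˡ-≤ (rank M) (rank M) a (subst₂ (λ x y → x + y ≤ rank M + a) p q total)))
      conclude (inj₁ p) (inj₂ q) = contradiction 0<t (<⇒≱
        (s≤s (linear (rank M ∷ a ∷ t ∷ [])
          (λ k a t → (k :+ (a :+ t) :≤ k :+ a) ∷ [] ⊢ t :≤ con 0)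
          (subst₂ (λ x y → x + y ≤ rank M + a) p q total ∷ []))))
      conclude (inj₂ p) (inj₁ q) = D⊆A⇒splits (∣─∣≤0⇒⊆
        (linear (rank M ∷ a ∷ s ∷ [])
          (λ k a s → (a :+ s :+ k :≤ k :+ a) ∷ [] ⊢ s :≤ con 0)
          (subst₂ (λ x y → x + y ≤ rank M + a) p q total ∷ [])))
      conclude (inj₂ p) (inj₂ q) =
        linear (rank M ∷ a ∷ s ∷ t ∷ rk M (E M ─ A) ∷ ∣ E M ─ A ∣ ∷ [])
          (λ k a s t r c → (a :+ s :+ (a :+ t) :≤ k :+ a) ∷ (r :≤ c) ∷ (c :≤ s :+ t) ∷ [] ⊢ a :+ r :≤ k)
          ( subst₂ (λ x y → x + y ≤ rank M + a) p q total ∷ rk≤∣∣ M (E M ─ A)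
          ∷ sets (A ∷ D ∷ E M ∷ [])
              (λ A D E → [] ⊢ ∣ E ─′ A ∣′ ≤′ ∣ D ─′ A ∣′ +′ ∣ E ─′ D ∣′) []
          ∷ [])

    -- A set `A` of rank 0 splits off trivially. Otherwise `M ∣ᴹ A` is uniform, dependent and of
    -- positive rank, so `A` lies on one side of `D` and `separator-⊇⇒splits` applies to that side.
    separator⇒splits : ∀ {D} → Separator M (E M) D → rk M A + rk M (E M ─ A) ≤ rank M
    separator⇒splits {D} sep with rk M A ≤? 0 | nonempty? (A ∩ D) | nonempty? (A ─ D)
    ... | yes a≤0 | _ | _ = +-mono-≤ a≤0 (rk≤rank M (E M ─ A))
    ... | no _ | no empty | _ = separator-⊇⇒splits
      (sets (A ∷ D ∷ E M ∷ []) (λ A D E → (A , E) ∷ (A ∩′ D , ⊥′) ∷ [] ⊢ A ⊆′ E ─′ D)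
        (⊆E ∷ empty⇒⊆⊥ empty ∷ []))
      (separator-comm M sep)
    ... | no _ | yes _ | no empty = separator-⊇⇒splits
      (sets (A ∷ D ∷ []) (λ A D → (A ─′ D , ⊥′) ∷ [] ⊢ A ⊆′ D) (empty⇒⊆⊥ empty ∷ [])) sep
    ... | no a≰0 | yes p | yes q = contradiction 0<a (≤⇒≯ (conclude (⊓-sel a x) (⊓-sel a y)))
      where
      a x y : ℕ
      a = rk M A
      x = ∣ A ∩ D ∣
      y = ∣ A ─ D ∣

      0<a : 1 ≤ a
      0<a = ≰⇒> a≰0

      total : a ⊓ x + a ⊓ y ≤ a
      total = ≤-trans (+-mono-≤ (lower (p∩q⊆p A D)) (lower (p─q⊆p A D)))
        (split-⊆ M (Separator.splits sep) ⊆E)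

      conclude : a ⊓ x ≡ a ⊎ a ⊓ x ≡ x → a ⊓ y ≡ a ⊎ a ⊓ y ≡ y → a ≤ 0
      conclude (inj₁ p′) (inj₁ q′) = linear (a ∷ []) (λ a → (a :+ a :≤ a) ∷ [] ⊢ a :≤ con 0)
        (subst₂ (λ x y → x + y ≤ a) p′ q′ total ∷ [])
      conclude (inj₁ p′) (inj₂ q′) = contradiction (nonempty⇒0< q) (≤⇒≯
        (linear (a ∷ y ∷ []) (λ a y → (a :+ y :≤ a) ∷ [] ⊢ y :≤ con 0)
          (subst₂ (λ x y → x + y ≤ a) p′ q′ total ∷ [])))
      conclude (inj₂ p′) (inj₁ q′) = contradiction (nonempty⇒0< p) (≤⇒≯
        (linear (a ∷ x ∷ []) (λ a x → (x :+ a :≤ a) ∷ [] ⊢ x :≤ con 0)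
          (subst₂ (λ x y → x + y ≤ a) p′ q′ total ∷ [])))
      conclude (inj₂ p′) (inj₂ q′) = contradiction dependent (≤⇒≯ (≤-trans
        (sets (A ∷ D ∷ []) (λ A D → [] ⊢ ∣ A ∣′ ≤′ ∣ A ∩′ D ∣′ +′ ∣ A ─′ D ∣′) [])
        (subst₂ (λ x y → x + y ≤ a) p′ q′ total)))

-- If `M` is disconnected, an empty list means that `M` is itself uniform, and otherwise the first
-- listed set already splits `M`.
relaxes-to-uniform⇒elementarySplit : ∀ {M N : Matroid u} {Fs n} → ListsStressed M Fs →
                                     Relaxes M Fs N → IsU (rank M) n N → ElementarySplit M
relaxes-to-uniform⇒elementarySplit {M = M} lists rels isU with connected? M
... | inj₁ connected =
  inj₁ (connected , splitFlacet-stressed M (uniform-relaxation⇒covered lists rels isU))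
relaxes-to-uniform⇒elementarySplit {M = M} lists [] isU | inj₂ _ =
  uniform⇒elementarySplit M (_ , _ , isU)
relaxes-to-uniform⇒elementarySplit {M = M} {Fs = F ∷ _} lists (_ ∷ _) _ | inj₂ (D , sep) =
  stressed-splits⇒elementarySplit M (Relaxable.bounds relaxable) (separator⇒splits M relaxable sep)
  where
  relaxable : Relaxable M F
  relaxable = let stressed , nonempty = Equivalence.to (ListsStressed.complete lists F) (here refl)
              in cover⇒relaxable M stressed nonempty

theorem1p2 : ∀ {u : ℕ} (M : Matroid u) (k n : ℕ) → Matroid.rank M ≡ k → Matroid.size M ≡ n →
    (Fs : List (Subset u)) → ListsStressed M Fs →
    ElementarySplit M ⇔ (∃[ N ] Relaxes M Fs N × IsU k n N)
theorem1p2 M k n refl refl Fs lists = mk⇔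
  (λ split → relaxes-to-uniform lists (elementarySplit⇒covered M split))
  (λ (N , rels , isU) → relaxes-to-uniform⇒elementarySplit lists rels isU)
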